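{- For every $t\in\mathbb{N}$, there is an isolation scheme for Hamiltonian cycles in graphs of treewidth at most $t$ that uses $\mathcal{O}(t\log n+\log^2 n)$ random bits and assigns weights upper bounded by $2^{\mathcal{O}(t\log n+\log^2 n)}$ (where $n$ is the number of vertices and the constants in the $\mathcal{O}$-notation do not depend on $t$).
   Context: For a weight function $\omega\colon U\to\mathbb{N}$ and $X\subseteq U$, $\omega(X)=\sum_{e\in X}\omega(e)$; $\omega$ isolates $\mathcal{F}\subseteq 2^U$ if exactly one member of $\mathcal{F}$ attains the minimum weight. $\mathsf{HC}(G)$ is the family of edge sets of Hamiltonian cycles of $G$. An isolation scheme for Hamiltonian cycles on a graph class $\mathcal{C}$ is, for every $n$ and $m$, a list of weight functions $\omega_1,\ldots,\omega_\ell\colon[m]\to\mathbb{N}$ such that for every $n$-vertex graph $G\in\mathcal{C}$ with edge set identified with $[m]$, at least half of the $\omega_i$ isolate $\mathsf{HC}(G)$. It uses $\log\ell$ random bits; its maximum weight is the maximum value of the $\omega_i$.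
   Formalization: The isolation requirement is imposed only on graphs that have at least one Hamiltonian cycle, since an empty family HC(G) (for example of a path) has no member of minimum weight and so cannot be isolated. -}

module Defs where

open import Data.Nat using (ℕ; zero; suc; _+_; _*_; _∸_; _^_; _≤_; _<_)
open import Data.Nat.Logarithm using (⌈log₂_⌉)
open import Data.Fin using (Fin; toℕ) renaming (zero to fzero; suc to fsuc)
open import Data.Fin.Subset using (Subset; _∈_; ∣_∣)
open import Data.Vec using (Vec; lookup; tabulate; sum)
open import Data.Bool using (Bool; true; false; if_then_else_)
open import Data.Product using (Σ; ∃; ∃-syntax; _×_; _,_; proj₁; proj₂)
open import Data.Sum using (_⊎_)
open import Relation.Binary.PropositionalEquality using (_≡_)
open import Relation.Binary.Construct.Closure.ReflexiveTransitive using (Star)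
open import Function.Definitions using (Injective)

-- A finite simple graph with vertex set Fin n and edge set identified with Fin m.
-- Edge e joins the vertices proj₁ (ends e) and proj₂ (ends e); each edge is stored
-- with its endpoints in increasing order (no loops), and distinct edges have
-- distinct endpoint pairs (no parallel edges).
record Graph (n m : ℕ) : Set where
  field
    ends    : Fin m → Fin n × Fin n
    ordered : ∀ e → toℕ (proj₁ (ends e)) < toℕ (proj₂ (ends e))
    simple  : ∀ e f → ends e ≡ ends f → e ≡ f

open Graph public

Joins : ∀ {n m} → Graph n m → Fin m → Fin n → Fin n → Set
Joins G e u v = (ends G e ≡ (u , v)) ⊎ (ends G e ≡ (v , u))

CycSucc : ∀ {n} → Fin n → Fin n → Set
CycSucc {n} i j = (toℕ j ≡ suc (toℕ i)) ⊎ ((suc (toℕ i) ≡ n) × (toℕ j ≡ 0))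

IsHamCycle : ∀ {n m} → Graph n m → Subset m → Set
IsHamCycle {n} {m} G X =
  (3 ≤ n) ×
  (Σ (Fin n → Fin n) λ σ →
     Injective _≡_ _≡_ σ ×
     (∀ i j → CycSucc i j → ∃[ e ] Joins G e (σ i) (σ j)) ×
     (∀ e → (e ∈ X) → ∃[ i ] ∃[ j ] (CycSucc i j × Joins G e (σ i) (σ j))) ×
     (∀ e i j → CycSucc i j → Joins G e (σ i) (σ j) → e ∈ X))

weight : ∀ {m} → (Fin m → ℕ) → Subset m → ℕ
weight {m} ω X = sum (tabulate {n = m} λ e → if lookup X e then ω e else 0)

Isolates : ∀ {m} → (Fin m → ℕ) → (Subset m → Set) → Set
Isolates {m} ω F =
  ∃[ X ] (F X × (∀ Y → F Y → weight ω X ≤ weight ω Y) ×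
          (∀ Y → F Y → weight ω Y ≡ weight ω X → Y ≡ X))

-- Tree decompositions of width ≤ t.  The decomposition tree has node set
-- Fin (suc k); node (fsuc i) has parent `parent i`, whose index is ≤ i
-- (so it is a tree; every finite tree can be labelled this way).
TreeAdj : ∀ {k} → (Fin k → Fin (suc k)) → Fin (suc k) → Fin (suc k) → Set
TreeAdj parent x y = ∃[ i ] ((x ≡ fsuc i × y ≡ parent i) ⊎ (y ≡ fsuc i × x ≡ parent i))

record TreeDecomposition {n m : ℕ} (G : Graph n m) (t : ℕ) : Set where
  field
    k         : ℕ
    parent    : Fin k → Fin (suc k)
    parent<   : ∀ i → toℕ (parent i) ≤ toℕ i
    bag       : Fin (suc k) → Subset n
    width     : ∀ x → ∣ bag x ∣ ≤ suc t
    vcover    : ∀ v → ∃[ x ] (v ∈ bag x)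
    ecover    : ∀ e → ∃[ x ] (proj₁ (ends G e) ∈ bag x × proj₂ (ends G e) ∈ bag x)
    connected : ∀ v x y → v ∈ bag x → v ∈ bag y →
                Star (λ a b → TreeAdj parent a b × v ∈ bag a × v ∈ bag b) x y

TreewidthAtMost : ∀ {n m} → Graph n m → ℕ → Set
TreewidthAtMost G t = TreeDecomposition G t

HC : ∀ {n m} → Graph n m → Subset m → Set
HC G = IsHamCycle G

bound : ℕ → ℕ → ℕ → ℕ
bound c t n = c * (t * ⌈log₂ n ⌉ + ⌈log₂ n ⌉ * ⌈log₂ n ⌉)

-- A list ω₁..ω_ℓ of weight functions on [m] is an isolation scheme for
-- Hamiltonian cycles on n-vertex graphs of treewidth ≤ t: at least half of
-- the ωᵢ isolate HC(G), for every such G (having a Hamiltonian cycle).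
IsolatesHalf : ∀ {n m ℓ} → Graph n m → (Fin ℓ → Fin m → ℕ) → Set
IsolatesHalf {ℓ = ℓ} G ω =
  ∃[ S ] (ℓ ≤ 2 * ∣ S ∣ × (∀ i → i ∈ S → Isolates (ω i) (HC G)))

{-# OPTIONS --safe #-}
-- Write the edge set as A ∪ Aᶜ and let s vertices meet both sides. For X ⊆ A and Y ⊆ Aᶜ, the set X ∪ Y is
-- a Hamiltonian cycle iff it is 2-regular and an odd number of cuts, with one vertex kept on a fixed side,
-- is crossed by none of its edges. Both conditions see the other side only through the degrees and colours
-- of the s border vertices, so the matrix indexed by X and Y has rank at most 6^s over GF(2). If the
-- candidates X have distinct weights, a candidate whose row is a sum of lighter rows never extends to a
-- cycle of minimum weight; Gaussian elimination keeps 6^s candidates.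
-- A tree decomposition of width t yields a ternary decomposition of the edges of depth O(log n) all of
-- whose pieces have s = 2(t + 1). Going up one level combines 6^s candidates of each of three parts; one new
-- hash function per level, appended as less significant digits of the weight, makes the combinations of all
-- pieces of that level distinct, and elimination brings them down to 6^s again. A level costs O(t + log n)
-- random bits. Hash functions under which any two edge sets rarely collide are found greedily.
module Submission where

open import Defs
open import Data.Bool using (Bool; true; false; T; if_then_else_; _∧_; _∨_; _xor_; not)
open import Data.Bool.Properties using (∧-zeroʳ; ∧-identityʳ; xor-identityʳ; xor-same; xor-comm; xor-assoc; not-involutive; ∧-distribˡ-xor; ∧-distribʳ-xor) renaming (_≟_ to _≟ᵇ_)
open import Data.Bool.Solver using (module xor-∧-Solver)
open import Data.Fin using (Fin; zero; suc; toℕ; fromℕ<; inject₁; remQuot; combine)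
open import Data.Fin.Induction using (<-weakInduction)
open import Data.Fin.Properties using (_≟_; toℕ<n; toℕ-fromℕ<; toℕ-injective; toℕ-inject₁; any?; pigeonhole; suc-injective; injective⇒≤; combine-injective; combine-remQuot)
open import Data.Fin.Subset using (Subset; ∣_∣; _∪_) renaming (_∈_ to _∈ˢ_)
open import Data.Fin.Subset.Properties using (anySubset?)
open import Data.List as List using (List; []; _∷_; length; _++_; cartesianProduct; cartesianProductWith; concatMap; filter)
import Data.List.Membership.DecPropositional as DecMembership
open import Data.List.Membership.Propositional using (_∈_; _∉_; lose)
open import Data.List.Membership.Propositional.Properties using (∈-++⁺ˡ; ∈-++⁺ʳ; ∈-allFin; ∈-map⁺; ∈-cartesianProductWith⁺; ∈-cartesianProductWith⁻; ∈-cartesianProduct⁺; ∈-filter⁺; ∈-concatMap⁺)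
open import Data.List.Properties using (length-++; length-map; length-tabulate)
open import Data.List.Relation.Unary.All using (All; []; _∷_)
open import Data.List.Relation.Unary.Any using (here; there)
open import Data.Nat hiding (_≟_; parity)
open import Data.Nat.Induction using (<-wellFounded)
open import Data.Nat.Logarithm using (⌈log₂_⌉; ⌈log₂⌉-mono-≤; ⌈log₂⌈n/2⌉⌉≡⌈log₂n⌉∸1)
open import Data.Nat.Properties hiding (_≟_; suc-injective)
open import Data.Nat.Properties using () renaming (_≟_ to _≟ℕ_; suc-injective to suc-injectiveℕ)
open import Data.Nat.Tactic.RingSolver using (solve-∀)
open import Data.Product using (Σ; ∃; ∃-syntax; _×_; _,_; proj₁; proj₂)
open import Data.Sum as Sum using (_⊎_; inj₁; inj₂; [_,_]′)
open import Data.Vec as Vec using (Vec; []; _∷_; lookup; _[_]≔_)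
open import Data.Vec.Properties using (lookup∘tabulate; lookup∘update′; lookup-zipWith; lookup-replicate; []=⇒lookup; lookup⇒[]=; tabulate∘lookup; tabulate-cong; ≡-dec)
open import Function using (_∘_; id; mk⇔)
open import Function.Definitions using (Injective)
open import Induction.WellFounded using (Acc; acc)
open import Relation.Binary.Construct.Closure.ReflexiveTransitive using (Star; ε; _◅_; gmap; kleisliStar)
open import Relation.Binary.Definitions using (tri<; tri≈; tri>)
open import Relation.Binary.PropositionalEquality
open import Relation.Nullary using (¬_; Dec; yes; no; does; contradiction)
open import Relation.Nullary.Decidable using (dec-true; dec-false; does-⇔; _×-dec_)

-- Greedy hash families

-- Elimination is sound because, if a row with a 1 in column Y is a sum of lighter rows, an odd
-- number of those have a 1 there too, and any of them completes Y to a lighter cycle. The weights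
-- are fixed before the graph is known, while the pairs of candidates to be told apart depend on the
-- graph and on the hashes of lower levels. The hash family therefore bounds the collisions of every
-- pair of edge sets, by 1 + 2m whatever the size of the family, and a union bound over the pairs of
-- a level says which seeds are lost. There are D = depth + 1 rounds, the last one for the list at
-- the root. Each loses at most a 1/(2D) fraction, one half in total. Repeated halving of a tree
-- could cut out pieces that border on many bags. Only subtrees and path segments (a subtree minus a
-- subtree further down) occur as pieces here. They border on at most two bags, whence s = 2(t + 1).
-- Splitting a segment gives two segments and the subtree hanging between them, which is why three
-- parts are needed.

+-interchange : ∀ a b c d → a + b + (c + d) ≡ a + c + (b + d)
+-interchange = solve-∀

ind : Bool → ℕ
ind b = if b then 1 else 0

sumF : ∀ {n} → (Fin n → ℕ) → ℕ
sumF f = Vec.sum (Vec.tabulate f)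

sumOver : {A : Set} → (A → ℕ) → List A → ℕ
sumOver f [] = 0
sumOver f (x ∷ xs) = f x + sumOver f xs

sumOver-cong : {A : Set} {f g : A → ℕ} → (∀ x → f x ≡ g x) → ∀ xs → sumOver f xs ≡ sumOver g xs
sumOver-cong eq [] = refl
sumOver-cong eq (x ∷ xs) = cong₂ _+_ (eq x) (sumOver-cong eq xs)

sumOver-+ : {A : Set} (f g : A → ℕ) → ∀ xs → sumOver (λ x → f x + g x) xs ≡ sumOver f xs + sumOver g xs
sumOver-+ f g [] = refl
sumOver-+ f g (x ∷ xs) rewrite sumOver-+ f g xs = +-interchange (f x) (g x) (sumOver f xs) (sumOver g xs)

sumOver-const : {A : Set} (k : ℕ) (xs : List A) → sumOver (λ _ → k) xs ≡ length xs * k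
sumOver-const k [] = refl
sumOver-const k (x ∷ xs) = cong (k +_) (sumOver-const k xs)

∈⇒≤sumOver : {A : Set} (f : A → ℕ) {x : A} {xs : List A} → x ∈ xs → f x ≤ sumOver f xs
∈⇒≤sumOver f (here refl) = m≤m+n _ _
∈⇒≤sumOver f (there x∈) = ≤-trans (∈⇒≤sumOver f x∈) (m≤n+m _ _)

sumF-cong : ∀ {n} {f g : Fin n → ℕ} → (∀ i → f i ≡ g i) → sumF f ≡ sumF g
sumF-cong {zero} eq = refl
sumF-cong {suc n} eq = cong₂ _+_ (eq zero) (sumF-cong (eq ∘ suc))

sumF-mono : ∀ {n} {f g : Fin n → ℕ} → (∀ i → f i ≤ g i) → sumF f ≤ sumF g
sumF-mono {zero} le = z≤n
sumF-mono {suc n} le = +-mono-≤ (le zero) (sumF-mono (le ∘ suc))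

sumF-+ : ∀ {n} (f g : Fin n → ℕ) → sumF (λ i → f i + g i) ≡ sumF f + sumF g
sumF-+ {zero} f g = refl
sumF-+ {suc n} f g rewrite sumF-+ (f ∘ suc) (g ∘ suc) =
  +-interchange (f zero) (g zero) (sumF (f ∘ suc)) (sumF (g ∘ suc))

sumF-* : ∀ {n} (k : ℕ) (f : Fin n → ℕ) → sumF (λ i → k * f i) ≡ k * sumF f
sumF-* {zero} k f = sym (*-zeroʳ k)
sumF-* {suc n} k f rewrite sumF-* k (f ∘ suc) = sym (*-distribˡ-+ k (f zero) (sumF (f ∘ suc)))

sumF-const : ∀ n (k : ℕ) → sumF {n} (λ _ → k) ≡ n * k
sumF-const zero k = refl
sumF-const (suc n) k = cong (k +_) (sumF-const n k)

sumF-ind-≡ : ∀ n v → sumF {n} (λ a → ind (does (toℕ a ≟ℕ v))) ≤ 1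
sumF-ind-≡ zero v = z≤n
sumF-ind-≡ (suc n) zero = ≤-reflexive (cong suc (trans (sumF-const n 0) (*-zeroʳ n)))
sumF-ind-≡ (suc n) (suc v) = sumF-ind-≡ n v

sumF-sumOver-swap : ∀ {n} {A : Set} (f : Fin n → A → ℕ) (xs : List A) →
  sumF (λ i → sumOver (f i) xs) ≡ sumOver (λ x → sumF (λ i → f i x)) xs
sumF-sumOver-swap {n} f [] = trans (sumF-const n 0) (*-zeroʳ n)
sumF-sumOver-swap f (x ∷ xs) =
  trans (sumF-+ (λ i → f i x) (λ i → sumOver (f i) xs)) (cong (sumF (λ i → f i x) +_) (sumF-sumOver-swap f xs))

sumOver-tabulate : ∀ {n} {A : Set} (f : A → ℕ) (g : Fin n → A) → sumOver f (List.tabulate g) ≡ sumF (f ∘ g)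
sumOver-tabulate {zero} f g = refl
sumOver-tabulate {suc n} f g = cong (f (g zero) +_) (sumOver-tabulate f (g ∘ suc))

sumOver-mono : {A : Set} {f g : A → ℕ} → (∀ x → f x ≤ g x) → ∀ xs → sumOver f xs ≤ sumOver g xs
sumOver-mono le [] = z≤n
sumOver-mono le (x ∷ xs) = +-mono-≤ (le x) (sumOver-mono le xs)

below-average : ∀ n (f : Fin (suc n) → ℕ) → ∃[ a ] suc n * f a ≤ sumF f
below-average zero f = zero , ≤-refl
below-average (suc n) f with below-average n (f ∘ suc)
... | a , le with f zero ≤? f (suc a)
...   | yes p = zero , +-monoʳ-≤ (f zero) (≤-trans (*-monoʳ-≤ (suc n) p) le)
...   | no ¬p = suc a , +-mono-≤ (<⇒≤ (≰⇒> ¬p)) le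

-- Agreements are penalised by powers of two: choosing each value below average keeps the total
-- penalty from growing by more than a factor 1 + 1/R.
agree : ∀ {L R} → (Fin L → Fin R) → (Fin L → ℕ) → ℕ
agree c g = sumF (λ i → ind (does (toℕ (c i) ≟ℕ g i)))

2^ind : ∀ b → 2 ^ ind b ≡ 1 + ind b
2^ind true = refl
2^ind false = refl

-- Method of conditional expectations. `w` carries the penalties of the coordinates already fixed,
-- so the induction runs over arbitrary weights. Each `x` is hit by at most one of the `suc r`
-- values of the next coordinate, so some value hits at most a `1 / suc r` share of the total, and
-- fixing it multiplies the total by at most `(2 + r) / suc r`.
avoid : {A : Set} (xs : List A) (r : ℕ) → ∀ L (w : A → ℕ) (g : A → Fin L → ℕ) →
  Σ (Fin L → Fin (suc r)) λ c →
    sumOver (λ x → w x * 2 ^ agree c (g x)) xs * suc r ^ L ≤ sumOver w xs * (2 + r) ^ L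
avoid xs r zero w g = (λ ()) , *-monoˡ-≤ 1 (≤-reflexive (sumOver-cong (λ x → *-identityʳ (w x)) xs))
avoid {A} xs r (suc L) w g = c , total≤′
  where
  hit : Fin (suc r) → A → ℕ
  hit a x = ind (does (toℕ a ≟ℕ g x zero))
  total≤ : sumF (λ a → sumOver (λ x → w x * hit a x) xs) ≤ sumOver w xs
  total≤ = begin
    sumF (λ a → sumOver (λ x → w x * hit a x) xs) ≡⟨ sumF-sumOver-swap (λ a x → w x * hit a x) xs ⟩
    sumOver (λ x → sumF (λ a → w x * hit a x)) xs ≤⟨ mono xs ⟩
    sumOver w xs ∎
    where
    open ≤-Reasoning
    mono : ∀ ys → sumOver (λ x → sumF (λ a → w x * hit a x)) ys ≤ sumOver w ys
    mono [] = z≤n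
    mono (y ∷ ys) = +-mono-≤
      (≤-trans (≤-reflexive (sumF-* (w y) (λ a → hit a y)))
        (≤-trans (*-monoʳ-≤ (w y) (sumF-ind-≡ (suc r) (g y zero))) (≤-reflexive (*-identityʳ (w y)))))
      (mono ys)
  chosen = below-average r (λ a → sumOver (λ x → w x * hit a x) xs)
  a = proj₁ chosen
  w′ : A → ℕ
  w′ x = w x * 2 ^ hit a x
  rest = avoid xs r L w′ (λ x → g x ∘ suc)
  c : Fin (suc L) → Fin (suc r)
  c zero = a
  c (suc i) = proj₁ rest i
  w′-split : sumOver w′ xs ≡ sumOver w xs + sumOver (λ x → w x * hit a x) xs
  w′-split = trans
    (sumOver-cong (λ x → trans (cong (w x *_) (2^ind (does (toℕ a ≟ℕ g x zero))))
                               (trans (*-distribˡ-+ (w x) 1 (hit a x)) (cong (_+ w x * hit a x) (*-identityʳ (w x))))) xs)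
    (sumOver-+ w (λ x → w x * hit a x) xs)
  growth : suc r * sumOver w′ xs ≤ (2 + r) * sumOver w xs
  growth = begin
    suc r * sumOver w′ xs ≡⟨ cong (suc r *_) w′-split ⟩
    suc r * (sumOver w xs + sumOver (λ x → w x * hit a x) xs) ≡⟨ *-distribˡ-+ (suc r) (sumOver w xs) _ ⟩
    suc r * sumOver w xs + suc r * sumOver (λ x → w x * hit a x) xs
      ≤⟨ +-monoʳ-≤ (suc r * sumOver w xs) (≤-trans (proj₂ chosen) total≤) ⟩
    suc r * sumOver w xs + sumOver w xs ≡⟨ +-comm (suc r * sumOver w xs) _ ⟩
    (2 + r) * sumOver w xs ∎
    where open ≤-Reasoning
  S′ = sumOver (λ x → w′ x * 2 ^ agree (proj₁ rest) (g x ∘ suc)) xs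
  total≤′ : sumOver (λ x → w x * 2 ^ agree c (g x)) xs * suc r ^ suc L ≤ sumOver w xs * (2 + r) ^ suc L
  total≤′ = begin
    sumOver (λ x → w x * 2 ^ agree c (g x)) xs * suc r ^ suc L
      ≡⟨ cong (_* suc r ^ suc L) (sumOver-cong (λ x →
           trans (cong (w x *_) (^-distribˡ-+-* 2 (hit a x) _)) (sym (*-assoc (w x) _ _))) xs) ⟩
    S′ * (suc r * suc r ^ L) ≡⟨ swap S′ (suc r) (suc r ^ L) ⟩
    suc r * (S′ * suc r ^ L) ≤⟨ *-monoʳ-≤ (suc r) (proj₂ rest) ⟩
    suc r * (sumOver w′ xs * (2 + r) ^ L) ≡⟨ sym (*-assoc (suc r) (sumOver w′ xs) _) ⟩
    suc r * sumOver w′ xs * (2 + r) ^ L ≤⟨ *-monoˡ-≤ ((2 + r) ^ L) growth ⟩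
    (2 + r) * sumOver w xs * (2 + r) ^ L ≡⟨ swap′ (2 + r) (sumOver w xs) ((2 + r) ^ L) ⟩
    sumOver w xs * (2 + r) ^ suc L ∎
    where
    open ≤-Reasoning
    swap : ∀ x y z → x * (y * z) ≡ y * (x * z)
    swap = solve-∀
    swap′ : ∀ x y z → x * y * z ≡ y * (x * z)
    swap′ = solve-∀

-- This is (1 + 1/R)^j ≤ 1 + 2j/R with denominators cleared. The inductive step leaves a term 2j,
-- which the hypothesis bounds by a spare `R`.
power-growth : ∀ R j → 2 * j ≤ R → suc R ^ j * R ≤ R ^ j * (R + 2 * j)
power-growth R zero le = ≤-reflexive (cong (1 *_) (sym (+-identityʳ R)))
power-growth R (suc j) le = begin
  suc R * suc R ^ j * R ≡⟨ *-assoc (suc R) (suc R ^ j) R ⟩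
  suc R * (suc R ^ j * R) ≤⟨ *-monoʳ-≤ (suc R) (power-growth R j 2j≤R) ⟩
  suc R * (R ^ j * (R + 2 * j)) ≡⟨ swap (suc R) (R ^ j) (R + 2 * j) ⟩
  R ^ j * (suc R * (R + 2 * j)) ≤⟨ *-monoʳ-≤ (R ^ j) step ⟩
  R ^ j * (R * (R + 2 * suc j)) ≡⟨ assoc′ (R ^ j) R (R + 2 * suc j) ⟩
  R * R ^ j * (R + 2 * suc j) ∎
  where
  open ≤-Reasoning
  2j≤R : 2 * j ≤ R
  2j≤R = ≤-trans (*-monoʳ-≤ 2 (n≤1+n j)) le
  swap : ∀ x y z → x * (y * z) ≡ y * (x * z)
  swap = solve-∀
  assoc′ : ∀ x y z → x * (y * z) ≡ y * x * z
  assoc′ = solve-∀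
  expand : ∀ R j → suc R * (R + 2 * j) ≡ R * R + 2 * j * R + R + 2 * j
  expand = solve-∀
  expand′ : ∀ R j → R * R + 2 * j * R + R + R ≡ R * (R + 2 * suc j)
  expand′ = solve-∀
  step : suc R * (R + 2 * j) ≤ R * (R + 2 * suc j)
  step = begin
    suc R * (R + 2 * j) ≡⟨ expand R j ⟩
    R * R + 2 * j * R + R + 2 * j ≤⟨ +-monoʳ-≤ (R * R + 2 * j * R + R) 2j≤R ⟩
    R * R + 2 * j * R + R + R ≡⟨ expand′ R j ⟩
    R * (R + 2 * suc j) ∎

power-ratio≤2 : ∀ r L → 2 * L ≤ suc r → (2 + r) ^ L ≤ 2 * suc r ^ L
power-ratio≤2 r L le = *-cancelʳ-≤ _ _ (suc r) (begin
  (2 + r) ^ L * suc r ≤⟨ power-growth (suc r) L le ⟩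
  suc r ^ L * (suc r + 2 * L) ≤⟨ *-monoʳ-≤ (suc r ^ L) (+-monoʳ-≤ (suc r) le) ⟩
  suc r ^ L * (suc r + suc r) ≡⟨ dbl (suc r ^ L) (suc r) ⟩
  2 * suc r ^ L * suc r ∎)
  where
  open ≤-Reasoning
  dbl : ∀ x y → x * (y + y) ≡ 2 * x * y
  dbl = solve-∀

-- One term of the penalty sum is at most the whole sum, and `2 * L ≤ suc r` keeps the accumulated
-- growth below a factor 2. Agreements are thus logarithmic in the length of `xs`, independently of
-- `L`.
avoid-all : {A : Set} (xs : List A) (r L : ℕ) → 2 * L ≤ suc r → (g : A → Fin L → ℕ) →
  Σ (Fin L → Fin (suc r)) λ c → ∀ {x} → x ∈ xs → 2 ^ agree c (g x) ≤ 2 * length xs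
avoid-all xs r L le g with avoid xs r L (λ _ → 1) g
... | c , le′ = c , λ {x} x∈ → ≤-trans (∈⇒≤sumOver (λ x → 2 ^ agree c (g x)) x∈)
    (*-cancelʳ-≤ _ _ (suc r ^ L) {{m^n≢0 (suc r) L}} (begin
      sumOver (λ x → 2 ^ agree c (g x)) xs * suc r ^ L
        ≡⟨ cong (_* suc r ^ L) (sumOver-cong (λ x → sym (*-identityˡ _)) xs) ⟩
      sumOver (λ x → 1 * 2 ^ agree c (g x)) xs * suc r ^ L ≤⟨ le′ ⟩
      sumOver (λ _ → 1) xs * (2 + r) ^ L
        ≡⟨ cong (_* (2 + r) ^ L) (trans (sumOver-const 1 xs) (*-identityʳ (length xs))) ⟩
      length xs * (2 + r) ^ L ≤⟨ *-monoʳ-≤ (length xs) (power-ratio≤2 r L le) ⟩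
      length xs * (2 * suc r ^ L) ≡⟨ swap (length xs) (suc r ^ L) ⟩
      2 * length xs * suc r ^ L ∎))
  where
  open ≤-Reasoning
  swap : ∀ x y → x * (2 * y) ≡ 2 * x * y
  swap = solve-∀

length-cartesianProductWith : {A B C : Set} (f : A → B → C) (xs : List A) (ys : List B) →
  length (cartesianProductWith f xs ys) ≡ length xs * length ys
length-cartesianProductWith f [] ys = refl
length-cartesianProductWith f (x ∷ xs) ys = trans (length-++ (List.map (f x) ys))
  (cong₂ _+_ (length-map (f x) ys) (length-cartesianProductWith f xs ys))

allSubsets : ∀ m → List (Subset m)
allSubsets zero = [] ∷ []
allSubsets (suc m) = List.map (false ∷_) (allSubsets m) ++ List.map (true ∷_) (allSubsets m)

∈-allSubsets : ∀ {m} (X : Subset m) → X ∈ allSubsets m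
∈-allSubsets [] = here refl
∈-allSubsets (false ∷ X) = ∈-++⁺ˡ (∈-map⁺ (false ∷_) (∈-allSubsets X))
∈-allSubsets {suc m} (true ∷ X) = ∈-++⁺ʳ (List.map (false ∷_) (allSubsets m)) (∈-map⁺ (true ∷_) (∈-allSubsets X))

length-allSubsets : ∀ m → length (allSubsets m) ≡ 2 ^ m
length-allSubsets zero = refl
length-allSubsets (suc m) = trans (length-++ (List.map (false ∷_) (allSubsets m)))
  (cong₂ _+_ (half (false ∷_)) (trans (half (true ∷_)) (sym (+-identityʳ (2 ^ m)))))
  where
  half : (f : Subset m → Subset (suc m)) → length (List.map f (allSubsets m)) ≡ 2 ^ m
  half f = trans (length-map f (allSubsets m)) (length-allSubsets m)

collisions : ∀ {L m} → (Fin L → Fin m → ℕ) → Subset m → Subset m → ℕ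
collisions H X Y = sumF (λ i → ind (does (weight (H i) X ≟ℕ weight (H i) Y)))

ind-mono : {P Q : Set} (p : Dec P) (q : Dec Q) → (P → Q) → ind (does p) ≤ ind (does q)
ind-mono (no _) q f = z≤n
ind-mono (yes p) q f rewrite dec-true q (f p) = ≤-refl

2^-cancel-≤ : ∀ a b → 2 ^ a ≤ 2 ^ b → a ≤ b
2^-cancel-≤ a b le with a ≤? b
... | yes p = p
... | no ¬p = contradiction le (<⇒≱ (^-monoʳ-< 2 (s≤s (s≤s z≤n)) (≰⇒> ¬p)))

-- Induction on the edges, fixing the weight of one more edge in all `L` functions. Sets that agree
-- on the new edge collide as before. Sets that differ there collide only where the new weight
-- equals a prescribed difference of old weights. There are 4^m prescriptions, so each is met at
-- most log (2 * 4^m) = 1 + 2m times.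
hash-family : ∀ m L r → 2 * L ≤ suc r →
  Σ (Fin L → Fin m → ℕ) λ H →
    (∀ i e → H i e ≤ r) × (∀ X Y → ¬ X ≡ Y → collisions H X Y ≤ 1 + 2 * m)
hash-family zero L r le = (λ _ ()) , (λ _ ()) , λ { [] [] X≢Y → contradiction refl X≢Y }
hash-family (suc m) L r le = H , bounded , few
  where
  IH = hash-family m L r le
  H′ = proj₁ IH
  pairs : List (Subset m × Subset m)
  pairs = cartesianProduct (allSubsets m) (allSubsets m)
  -- Truncated subtraction is harmless: a collision equates one weight with `c i` plus the other,
  -- and then the difference is exact.
  target : Subset m × Subset m → Fin L → ℕ
  target (X , Y) i = weight (H′ i) Y ∸ weight (H′ i) X
  chosen = avoid-all pairs r L le target
  c = proj₁ chosen
  H : Fin L → Fin (suc m) → ℕ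
  H i zero = toℕ (c i)
  H i (suc e) = H′ i e
  bounded : ∀ i e → H i e ≤ r
  bounded i zero = s≤s⁻¹ (toℕ<n (c i))
  bounded i (suc e) = proj₁ (proj₂ IH) i e
  cartesian : length pairs ≡ 2 ^ m * 2 ^ m
  cartesian = trans (length-cartesianProductWith _,_ (allSubsets m) (allSubsets m)) (cong₂ _*_ (length-allSubsets m) (length-allSubsets m))
  few-agree : ∀ X Y → agree c (target (X , Y)) ≤ 1 + 2 * m
  few-agree X Y = 2^-cancel-≤ _ _ (≤-trans (proj₂ chosen (∈-cartesianProduct⁺ (∈-allSubsets X) (∈-allSubsets Y)))
    (≤-reflexive (cong (2 *_) (trans cartesian (trans (sym (^-distribˡ-+-* 2 m m)) (cong (λ k → 2 ^ (m + k)) (sym (+-identityʳ m))))))))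
  widen : 1 + 2 * m ≤ 1 + 2 * suc m
  widen = s≤s (*-monoʳ-≤ 2 (n≤1+n m))
  mixed : ∀ X Y (i : Fin L) → toℕ (c i) + weight (H′ i) X ≡ weight (H′ i) Y → toℕ (c i) ≡ target (X , Y) i
  mixed X Y i eq = trans (sym (m+n∸n≡m (toℕ (c i)) (weight (H′ i) X))) (cong (_∸ weight (H′ i) X) eq)
  few : ∀ X Y → ¬ X ≡ Y → collisions H X Y ≤ 1 + 2 * suc m
  few (false ∷ X) (false ∷ Y) ne = ≤-trans (proj₂ (proj₂ IH) X Y (ne ∘ cong (false ∷_))) widen
  few (true ∷ X) (true ∷ Y) ne = ≤-trans
    (≤-trans (sumF-mono λ i → ind-mono (_ ≟ℕ _) (_ ≟ℕ _) (+-cancelˡ-≡ (toℕ (c i)) (weight (H′ i) X) (weight (H′ i) Y)))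
      (proj₂ (proj₂ IH) X Y (ne ∘ cong (true ∷_)))) widen
  few (true ∷ X) (false ∷ Y) ne = ≤-trans
    (≤-trans (sumF-mono λ i → ind-mono (_ ≟ℕ _) (_ ≟ℕ _) (mixed X Y i)) (few-agree X Y)) widen
  few (false ∷ X) (true ∷ Y) ne = ≤-trans
    (≤-trans (sumF-mono λ i → ind-mono (_ ≟ℕ _) (_ ≟ℕ _) (mixed Y X i ∘ sym)) (few-agree Y X)) widen

-- Gaussian elimination over GF(2)

-- The matrix Φ has rank at most r over GF(2).
data Rank {U W : Set} : ℕ → (U → W → Bool) → Set where
  rank-0 : ∀ {Φ} → (∀ x y → Φ x y ≡ false) → Rank 0 Φ
  rank-suc : ∀ {r Φ Ψ} (p : U → Bool) (q : W → Bool) → Rank r Ψ →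
         (∀ x y → Φ x y ≡ (p x ∧ q y) xor Ψ x y) → Rank (suc r) Φ

rank-cong : ∀ {U W : Set} {r} {Φ Ψ : U → W → Bool} → (∀ x y → Ψ x y ≡ Φ x y) → Rank r Φ → Rank r Ψ
rank-cong eq (rank-0 z) = rank-0 λ x y → trans (eq x y) (z x y)
rank-cong eq (rank-suc p q R e) = rank-suc p q R λ x y → trans (eq x y) (e x y)

rank-∧₁ : ∀ {U W : Set} (p : U → Bool) (q : W → Bool) → Rank 1 (λ x y → p x ∧ q y)
rank-∧₁ p q = rank-suc p q (rank-0 {Φ = λ _ _ → false} λ _ _ → refl) λ x y → sym (xor-identityʳ _)

rank-xor : ∀ {U W : Set} {r s} {Φ Ψ : U → W → Bool} → Rank r Φ → Rank s Ψ → Rank (r + s) (λ x y → Φ x y xor Ψ x y)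
rank-xor {Ψ = Ψ} (rank-0 z) S = rank-cong (λ x y → cong (_xor Ψ x y) (z x y)) S
rank-xor {Ψ = Ψ} (rank-suc {Ψ = Φ′} p q R e) S = rank-suc p q (rank-xor R S) λ x y →
  trans (cong (_xor Ψ x y) (e x y)) (xor-assoc (p x ∧ q y) (Φ′ x y) (Ψ x y))

rank-scale : ∀ {U W : Set} {r} {Φ : U → W → Bool} (p : U → Bool) (q : W → Bool) →
  Rank r Φ → Rank r (λ x y → (p x ∧ q y) ∧ Φ x y)
rank-scale p q (rank-0 z) = rank-0 λ x y → trans (cong ((p x ∧ q y) ∧_) (z x y)) (∧-zeroʳ (p x ∧ q y))
rank-scale p q (rank-suc {Ψ = Ψ} p′ q′ R e) =
  rank-suc (λ x → p x ∧ p′ x) (λ y → q y ∧ q′ y) (rank-scale p q R) λ x y →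
    trans (cong ((p x ∧ q y) ∧_) (e x y)) (distrib (p x) (q y) (p′ x) (q′ y) (Ψ x y))
  where
  open xor-∧-Solver
  distrib : ∀ a b c d e → (a ∧ b) ∧ ((c ∧ d) xor e) ≡ ((a ∧ c) ∧ (b ∧ d)) xor ((a ∧ b) ∧ e)
  distrib = solve 5 (λ a b c d e → (a :* b) :* ((c :* d) :+ e) := ((a :* c) :* (b :* d)) :+ ((a :* b) :* e)) refl

-- In an entrywise product, a rank-one term of `Φ` merely masks rows and columns of `Ψ`, so each of
-- the `r` terms contributes rank at most `s`.
rank-∧ : ∀ {U W : Set} {r s} {Φ Ψ : U → W → Bool} → Rank r Φ → Rank s Ψ → Rank (r * s) (λ x y → Φ x y ∧ Ψ x y)
rank-∧ {Ψ = Ψ} (rank-0 z) S = rank-0 λ x y → cong (_∧ Ψ x y) (z x y)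
rank-∧ {Ψ = Ψ} (rank-suc {Ψ = Φ′} p q R e) S = rank-cong
  (λ x y → trans (cong (_∧ Ψ x y) (e x y)) (∧-distribʳ-xor (Ψ x y) (p x ∧ q y) (Φ′ x y)))
  (rank-xor (rank-scale p q S) (rank-∧ R S))

-- Adding copies of row `x₀` changes only the row factor of each rank-one term, so the number of
-- terms stays the same.
rank-add-row : ∀ {U W : Set} {r} {Φ : U → W → Bool} (b : U → Bool) (x₀ : U) →
  Rank r Φ → Rank r (λ x y → Φ x y xor (b x ∧ Φ x₀ y))
rank-add-row b x₀ (rank-0 z) = rank-0 λ x y → trans (cong₂ (λ u v → u xor (b x ∧ v)) (z x y) (z x₀ y)) (∧-zeroʳ (b x))
rank-add-row b x₀ (rank-suc {Ψ = Ψ} p q R e) =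
  rank-suc (λ x → p x xor (b x ∧ p x₀)) q (rank-add-row b x₀ R) λ x y →
    trans (cong₂ (λ u v → u xor (b x ∧ v)) (e x y) (e x₀ y))
      (regroup (p x) (q y) (Ψ x y) (b x) (p x₀) (Ψ x₀ y))
  where
  open xor-∧-Solver
  regroup : ∀ a c d b e f →
    ((a ∧ c) xor d) xor (b ∧ ((e ∧ c) xor f)) ≡ ((a xor (b ∧ e)) ∧ c) xor (d xor (b ∧ f))
  regroup = solve 6 (λ a c d b e f →
    ((a :* c) :+ d) :+ (b :* ((e :* c) :+ f)) := ((a :+ (b :* e)) :* c) :+ (d :+ (b :* f))) refl

argmin : {U : Set} (w : U → ℕ) (p : U → Bool) (C : List U) →
  (∀ {z} → z ∈ C → p z ≡ false) ⊎
  (∃[ x ] (x ∈ C × p x ≡ true × (∀ {z} → z ∈ C → p z ≡ true → w x ≤ w z)))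
argmin w p [] = inj₁ λ ()
argmin w p (c ∷ C) with p c in pc | argmin w p C
... | false | inj₁ all = inj₁ λ { (here refl) → pc ; (there z∈) → all z∈ }
... | false | inj₂ (x , x∈ , px , min) = inj₂ (x , there x∈ , px ,
  λ { (here refl) pz → contradiction (trans (sym pz) pc) λ () ; (there z∈) pz → min z∈ pz })
... | true | inj₁ all = inj₂ (c , here refl , pc ,
  λ { (here refl) _ → ≤-refl ; (there z∈) pz → contradiction (trans (sym pz) (all z∈)) λ () })
... | true | inj₂ (x , x∈ , px , min) with w c ≤? w x
...   | yes le = inj₂ (c , here refl , pc , λ { (here refl) _ → ≤-refl ; (there z∈) pz → ≤-trans le (min z∈ pz) })
...   | no nle = inj₂ (x , there x∈ , px , λ { (here refl) _ → <⇒≤ (≰⇒> nle) ; (there z∈) pz → min z∈ pz })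

StrictMin : {U W : Set} → (U → ℕ) → List U → (U → W → Bool) → U → W → Set
StrictMin w C Φ x y = Φ x y ≡ true × (∀ {z} → z ∈ C → Φ z y ≡ true → z ≡ x ⊎ w x < w z)

-- Gaussian elimination with pivots of least weight: a row that is a sum of strictly lighter rows is
-- never the strict minimum of a column.
representatives : {U W : Set} (w : U → ℕ) {r : ℕ} {Φ : U → W → Bool} → Rank r Φ → (C : List U) →
  ∃[ R ] (length R ≤ r × (∀ {x y} → x ∈ C → StrictMin w C Φ x y → x ∈ R))
representatives w (rank-0 z) C = [] , z≤n , (λ { _ (Φxy , _) → contradiction (trans (sym Φxy) (z _ _)) λ () })
representatives {U} {W} w {Φ = Φ} (rank-suc {Ψ = Ψ} p q R e) C with argmin w p C
... | inj₁ all =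
  let reps , len , keep = representatives w R C
      same : ∀ {x y} → x ∈ C → Φ x y ≡ Ψ x y
      same {x} {y} x∈ = trans (e x y) (cong (λ b → (b ∧ q y) xor Ψ x y) (all x∈))
  in reps , m≤n⇒m≤1+n len ,
     (λ x∈ (Φxy , min) → keep x∈ (trans (sym (same x∈)) Φxy , λ z∈ Ψzy → min z∈ (trans (same z∈) Ψzy)))
... | inj₂ (x₀ , x₀∈ , px₀ , least) =
  x₀ ∷ proj₁ IH , s≤s (proj₁ (proj₂ IH)) , keep
  where
  -- `x₀` is a lightest row that uses the first rank-one term. Adding it to every row that uses this
  -- term cancels `q`. The result is `Ψ′`, which `Ψ` shows to have rank at most one less.
  Ψ′ : U → W → Bool
  Ψ′ x y = Ψ x y xor (p x ∧ Ψ x₀ y)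
  IH = representatives w (rank-add-row p x₀ R) C
  eliminate : ∀ a c d f → d xor (a ∧ f) ≡ ((a ∧ c) xor d) xor (a ∧ (c xor f))
  eliminate true true true f = refl
  eliminate true true false f = sym (not-involutive f)
  eliminate true false true f = refl
  eliminate true false false f = refl
  eliminate false c d f = refl
  Ψ′-eq : ∀ x y → Ψ′ x y ≡ Φ x y xor (p x ∧ Φ x₀ y)
  Ψ′-eq x y = trans (eliminate (p x) (q y) (Ψ x y) (Ψ x₀ y))
    (cong₂ (λ u v → u xor (p x ∧ v)) (sym (e x y)) (sym (trans (e x₀ y) (cong (λ b → (b ∧ q y) xor Ψ x₀ y) px₀))))
  light : ∀ {x y} → p x ≡ false → Ψ′ x y ≡ Φ x y
  light {x} {y} px = trans (Ψ′-eq x y) (trans (cong (λ b → Φ x y xor (b ∧ Φ x₀ y)) px) (xor-identityʳ _))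
  unhit : ∀ {x y} → Φ x₀ y ≡ false → Ψ′ x y ≡ Φ x y
  unhit {x} {y} h = trans (Ψ′-eq x y) (trans (cong (λ b → Φ x y xor (p x ∧ b)) h) (zeroed (Φ x y) (p x)))
    where
    zeroed : ∀ a b → a xor (b ∧ false) ≡ a
    zeroed a true = xor-identityʳ a
    zeroed a false = xor-identityʳ a
  keep : ∀ {x y} → x ∈ C → StrictMin w C Φ x y → x ∈ (x₀ ∷ proj₁ IH)
  keep {x} {y} x∈ (Φxy , min) with Φ x₀ y in hit
  ... | false = there (proj₂ (proj₂ IH) x∈
          (trans (unhit hit) Φxy , λ z∈ Ψzy → min z∈ (trans (sym (unhit hit)) Ψzy)))
  -- Here `x₀` competes in column `y`, so `x` is `x₀` or strictly lighter. A lighter `x` has `p x`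
  -- false and its row is unchanged, while every changed row is at least as heavy as `x₀` and cannot
  -- threaten the strict minimum.
  ... | true with min x₀∈ hit
  ...   | inj₁ refl = here refl
  ...   | inj₂ lt with p x in px
  ...     | true = contradiction (least x∈ px) (<⇒≱ lt)
  ...     | false = there (proj₂ (proj₂ IH) x∈ (trans (light px) Φxy , min′))
    where
    min′ : ∀ {z} → z ∈ C → Ψ′ z y ≡ true → z ≡ x ⊎ w x < w z
    min′ {z} z∈ Ψzy with p z in pz
    ... | false = min z∈ (trans (sym (light pz)) (trans (cong (λ b → Ψ z y xor (b ∧ Ψ x₀ y)) pz) Ψzy))
    ... | true = inj₂ (<-≤-trans lt (least z∈ pz))

-- Hamiltonicity as a parity of cuts

allF : ∀ {n} → (Fin n → Bool) → Bool
allF {zero} f = true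
allF {suc n} f = f zero ∧ allF (f ∘ suc)

allF-cong : ∀ {n} {f g : Fin n → Bool} → (∀ i → f i ≡ g i) → allF f ≡ allF g
allF-cong {zero} eq = refl
allF-cong {suc n} eq = cong₂ _∧_ (eq zero) (allF-cong (eq ∘ suc))

allF-∧ : ∀ {n} (f g : Fin n → Bool) → allF (λ i → f i ∧ g i) ≡ allF f ∧ allF g
allF-∧ {zero} f g = refl
allF-∧ {suc n} f g = trans (cong ((f zero ∧ g zero) ∧_) (allF-∧ (f ∘ suc) (g ∘ suc)))
  (regroup (f zero) (g zero) (allF (f ∘ suc)) (allF (g ∘ suc)))
  where
  open xor-∧-Solver
  regroup : ∀ a b c d → (a ∧ b) ∧ (c ∧ d) ≡ (a ∧ c) ∧ (b ∧ d)
  regroup = solve 4 (λ a b c d → (a :* b) :* (c :* d) := (a :* c) :* (b :* d)) refl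

xorSum : ∀ n → (Vec Bool n → Bool) → Bool
xorSum zero f = f []
xorSum (suc n) f = xorSum n (f ∘ (false ∷_)) xor xorSum n (f ∘ (true ∷_))

xorSum-cong : ∀ n {f g : Vec Bool n → Bool} → (∀ c → f c ≡ g c) → xorSum n f ≡ xorSum n g
xorSum-cong zero eq = eq []
xorSum-cong (suc n) eq = cong₂ _xor_ (xorSum-cong n (λ c → eq (false ∷ c))) (xorSum-cong n (λ c → eq (true ∷ c)))

xorSum-xor : ∀ n (f g : Vec Bool n → Bool) → xorSum n (λ c → f c xor g c) ≡ xorSum n f xor xorSum n g
xorSum-xor zero f g = refl
xorSum-xor (suc n) f g = trans
  (cong₂ _xor_ (xorSum-xor n (λ c → f (false ∷ c)) (λ c → g (false ∷ c))) (xorSum-xor n (λ c → f (true ∷ c)) (λ c → g (true ∷ c))))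
  (regroup (xorSum n (λ c → f (false ∷ c))) (xorSum n (λ c → g (false ∷ c)))
           (xorSum n (λ c → f (true ∷ c))) (xorSum n (λ c → g (true ∷ c))))
  where
  open xor-∧-Solver
  regroup : ∀ a b c d → (a xor b) xor (c xor d) ≡ (a xor c) xor (b xor d)
  regroup = solve 4 (λ a b c d → (a :+ b) :+ (c :+ d) := (a :+ c) :+ (b :+ d)) refl

Indep : ∀ {U : Set} {n} → Fin n → (Vec Bool n → U → Bool) → Set
Indep i P = ∀ c x → P (c [ i ]≔ false) x ≡ P (c [ i ]≔ true) x

Indep-xor : ∀ {U : Set} {n} {i : Fin n} (P : Vec Bool (suc n) → U → Bool) → Indep (suc i) P →
  Indep i (λ c x → P (false ∷ c) x xor P (true ∷ c) x)
Indep-xor P indep c x = cong₂ _xor_ (indep (false ∷ c) x) (indep (true ∷ c) x)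

-- Only the coordinates in B are seen by both factors; every other one is summed inside one factor.
rank-xorSum : ∀ {U W : Set} n (B : Vec Bool n) (P : Vec Bool n → U → Bool) (Q : Vec Bool n → W → Bool) →
  (∀ i → lookup B i ≡ false → Indep i P ⊎ Indep i Q) →
  Rank (2 ^ ∣ B ∣) (λ x y → xorSum n (λ c → P c x ∧ Q c y))
rank-xorSum zero [] P Q sep = rank-∧₁ (P []) (Q [])
rank-xorSum (suc n) (true ∷ B) P Q sep =
  subst (λ k → Rank (2 ^ ∣ B ∣ + k) _) (sym (+-identityʳ (2 ^ ∣ B ∣))) (rank-xor (half false) (half true))
  where
  half : ∀ b → Rank (2 ^ ∣ B ∣) (λ x y → xorSum n (λ c → P (b ∷ c) x ∧ Q (b ∷ c) y))
  half b = rank-xorSum n B (λ c → P (b ∷ c)) (λ c → Q (b ∷ c)) restrict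
    where
    restrict : ∀ i → lookup B i ≡ false → Indep i (λ c → P (b ∷ c)) ⊎ Indep i (λ c → Q (b ∷ c))
    restrict i i∉ with sep (suc i) i∉
    ... | inj₁ ip = inj₁ λ c → ip (b ∷ c)
    ... | inj₂ iq = inj₂ λ c → iq (b ∷ c)
rank-xorSum {U} {W} (suc n) (false ∷ B) P Q sep with sep zero refl
... | inj₁ indep = rank-cong sum-Q (rank-xorSum n B P₀ Q⊕ restrict)
  where
  P₀ : Vec Bool n → U → Bool
  P₀ c = P (false ∷ c)
  Q⊕ : Vec Bool n → W → Bool
  Q⊕ c y = Q (false ∷ c) y xor Q (true ∷ c) y
  restrict : ∀ i → lookup B i ≡ false → Indep i P₀ ⊎ Indep i Q⊕
  restrict i i∉ with sep (suc i) i∉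
  ... | inj₁ ip = inj₁ λ c → ip (false ∷ c)
  ... | inj₂ iq = inj₂ (Indep-xor Q iq)
  sum-Q : ∀ x y → xorSum (suc n) (λ c → P c x ∧ Q c y) ≡ xorSum n (λ c → P₀ c x ∧ Q⊕ c y)
  sum-Q x y = trans (sym (xorSum-xor n (λ c → P (false ∷ c) x ∧ Q (false ∷ c) y) (λ c → P (true ∷ c) x ∧ Q (true ∷ c) y)))
    (xorSum-cong n λ c → trans (cong (λ b → (P (false ∷ c) x ∧ Q (false ∷ c) y) xor (b ∧ Q (true ∷ c) y)) (sym (indep (false ∷ c) x)))
      (sym (∧-distribˡ-xor (P (false ∷ c) x) (Q (false ∷ c) y) (Q (true ∷ c) y))))
... | inj₂ indep = rank-cong sum-P (rank-xorSum n B P⊕ Q₀ restrict)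
  where
  P⊕ : Vec Bool n → U → Bool
  P⊕ c x = P (false ∷ c) x xor P (true ∷ c) x
  Q₀ : Vec Bool n → W → Bool
  Q₀ c = Q (false ∷ c)
  restrict : ∀ i → lookup B i ≡ false → Indep i P⊕ ⊎ Indep i Q₀
  restrict i i∉ with sep (suc i) i∉
  ... | inj₁ ip = inj₁ (Indep-xor P ip)
  ... | inj₂ iq = inj₂ λ c → iq (false ∷ c)
  sum-P : ∀ x y → xorSum (suc n) (λ c → P c x ∧ Q c y) ≡ xorSum n (λ c → P⊕ c x ∧ Q₀ c y)
  sum-P x y = trans (sym (xorSum-xor n (λ c → P (false ∷ c) x ∧ Q (false ∷ c) y) (λ c → P (true ∷ c) x ∧ Q (true ∷ c) y)))
    (xorSum-cong n λ c → trans (cong (λ b → (P (false ∷ c) x ∧ Q (false ∷ c) y) xor (P (true ∷ c) x ∧ b)) (sym (indep (false ∷ c) y)))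
      (sym (∧-distribʳ-xor (Q (false ∷ c) y) (P (false ∷ c) x) (P (true ∷ c) x))))

-- Ranks multiply under conjunction, so the vertices with a factor of rank 1 cost nothing.
rank-allF : ∀ {U W : Set} {n} k (B : Vec Bool n) (Φ : Fin n → U → W → Bool) →
  (∀ v → lookup B v ≡ true → Rank k (Φ v)) → (∀ v → lookup B v ≡ false → Rank 1 (Φ v)) →
  Rank (k ^ ∣ B ∣) (λ x y → allF (λ v → Φ v x y))
rank-allF k [] Φ on off = rank-∧₁ (λ _ → true) (λ _ → true)
rank-allF k (true ∷ B) Φ on off = rank-∧ (on zero refl) (rank-allF k B (Φ ∘ suc) (on ∘ suc) (off ∘ suc))
rank-allF k (false ∷ B) Φ on off = subst (λ r → Rank r _) (*-identityˡ (k ^ ∣ B ∣))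
  (rank-∧ (off zero refl) (rank-allF k B (Φ ∘ suc) (on ∘ suc) (off ∘ suc)))

incident : ∀ {n m} → Graph n m → Fin m → Fin n → Bool
incident G e v = does (v ≟ proj₁ (ends G e)) ∨ does (v ≟ proj₂ (ends G e))

degIn : ∀ {n m} → Graph n m → (Fin m → Bool) → Subset m → Fin n → ℕ
degIn G A X v = sumF (λ e → ind (A e ∧ (lookup X e ∧ incident G e v)))

deg : ∀ {n m} → Graph n m → Subset m → Fin n → ℕ
deg G X v = sumF (λ e → ind (lookup X e ∧ incident G e v))

regular : ∀ {n m} → Graph n m → Subset m → Bool
regular G X = allF (λ v → deg G X v ≡ᵇ 2)

same : Bool → Bool → Bool
same a b = not (a xor b)

properIn : ∀ {n m} → Graph n m → (Fin m → Bool) → Vec Bool n → Subset m → Bool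
properIn G A c X = allF (λ e → not (A e ∧ lookup X e) ∨ same (lookup c (proj₁ (ends G e))) (lookup c (proj₂ (ends G e))))

proper : ∀ {n m} → Graph n m → Vec Bool n → Subset m → Bool
proper G c X = allF (λ e → not (lookup X e) ∨ same (lookup c (proj₁ (ends G e))) (lookup c (proj₂ (ends G e))))

-- X is 2-regular and has an odd number of cuts (vertex 2-colourings with vertex 0 on a fixed side)
-- crossed by no edge of X; the number of such cuts is 2^(components - 1).
oddCuts : ∀ {n m} → Graph (suc n) m → Subset m → Bool
oddCuts {n} G X = xorSum n (λ c → proper G (false ∷ c) X)

hamiltonian : ∀ {n m} → Graph (suc n) m → Subset m → Bool
hamiltonian G X = regular G X ∧ oddCuts G X

mix : ∀ {m} → (Fin m → Bool) → Subset m → Subset m → Subset m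
mix A X Y = Vec.tabulate (λ e → if A e then lookup X e else lookup Y e)

lookup-mix : ∀ {m} (A : Fin m → Bool) X Y e → lookup (mix A X Y) e ≡ (if A e then lookup X e else lookup Y e)
lookup-mix A X Y e = lookup∘tabulate _ e

Separates : ∀ {n m} → Graph n m → Vec Bool n → (Fin m → Bool) → Set
Separates G B A = ∀ v → lookup B v ≡ false →
  (∀ e → incident G e v ≡ true → A e ≡ true) ⊎ (∀ e → incident G e v ≡ true → A e ≡ false)

deg-mix : ∀ {n m} (G : Graph n m) A X Y v → deg G (mix A X Y) v ≡ degIn G A X v + degIn G (not ∘ A) Y v
deg-mix G A X Y v = trans (sumF-cong pointwise) (sumF-+ (λ e → ind (A e ∧ (lookup X e ∧ incident G e v))) _)
  where
  pointwise : ∀ e → ind (lookup (mix A X Y) e ∧ incident G e v) ≡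
    ind (A e ∧ (lookup X e ∧ incident G e v)) + ind (not (A e) ∧ (lookup Y e ∧ incident G e v))
  pointwise e rewrite lookup-mix A X Y e with A e
  ... | true = sym (+-identityʳ _)
  ... | false = refl

proper-mix : ∀ {n m} (G : Graph n m) A c X Y → proper G c (mix A X Y) ≡ properIn G A c X ∧ properIn G (not ∘ A) c Y
proper-mix G A c X Y = trans (allF-cong pointwise) 
  (allF-∧ (λ e → not (A e ∧ lookup X e) ∨ s e) (λ e → not (not (A e) ∧ lookup Y e) ∨ s e))
  where
  s : Fin _ → Bool
  s e = same (lookup c (proj₁ (ends G e))) (lookup c (proj₂ (ends G e)))
  pointwise : ∀ e → not (lookup (mix A X Y) e) ∨ s e ≡ (not (A e ∧ lookup X e) ∨ s e) ∧ (not (not (A e) ∧ lookup Y e) ∨ s e)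
  pointwise e rewrite lookup-mix A X Y e with A e
  ... | true = sym (∧-identityʳ _)
  ... | false = refl

degIn-zero : ∀ {n m} (G : Graph n m) A X v → (∀ e → incident G e v ≡ true → A e ≡ false) → degIn G A X v ≡ 0
degIn-zero {m = m} G A X v out = trans (sumF-cong pointwise) (trans (sumF-const m 0) (*-zeroʳ m))
  where
  pointwise : ∀ e → ind (A e ∧ (lookup X e ∧ incident G e v)) ≡ 0
  pointwise e with incident G e v | out e
  ... | true | o rewrite o refl = refl
  ... | false | _ with A e | lookup X e
  ...   | true | true = refl
  ...   | true | false = refl
  ...   | false | _ = refl

-- A border vertex splits its degree 2 as 0 + 2, 1 + 1 or 2 + 0. These cases exclude one another, so
-- their disjunction is an xor of three products. Any other vertex receives its whole degree from
-- one side.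
rank-regular : ∀ {n m} (G : Graph n m) (B : Vec Bool n) (A : Fin m → Bool) → Separates G B A →
  Rank (3 ^ ∣ B ∣) (λ X Y → regular G (mix A X Y))
rank-regular G B A sep = rank-allF 3 B (λ v X Y → deg G (mix A X Y) v ≡ᵇ 2) on off
  where
  split : ∀ a b → (a + b ≡ᵇ 2) ≡ ((a ≡ᵇ 0) ∧ (b ≡ᵇ 2)) xor (((a ≡ᵇ 1) ∧ (b ≡ᵇ 1)) xor ((a ≡ᵇ 2) ∧ (b ≡ᵇ 0)))
  split 0 b = sym (xor-identityʳ (b ≡ᵇ 2))
  split 1 b = sym (xor-identityʳ (b ≡ᵇ 1))
  split 2 b = refl
  split (suc (suc (suc a))) b = refl
  on : ∀ v → lookup B v ≡ true → Rank 3 (λ X Y → deg G (mix A X Y) v ≡ᵇ 2)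
  on v _ = rank-cong (λ X Y → trans (cong (_≡ᵇ 2) (deg-mix G A X Y v)) (split (degIn G A X v) (degIn G (not ∘ A) Y v)))
    (rank-xor (term 0 2) (rank-xor (term 1 1) (term 2 0)))
    where
    term : ∀ i j → Rank 1 (λ X Y → (degIn G A X v ≡ᵇ i) ∧ (degIn G (not ∘ A) Y v ≡ᵇ j))
    term i j = rank-∧₁ (λ X → degIn G A X v ≡ᵇ i) (λ Y → degIn G (not ∘ A) Y v ≡ᵇ j)
  off : ∀ v → lookup B v ≡ false → Rank 1 (λ X Y → deg G (mix A X Y) v ≡ᵇ 2)
  off v v∉ with sep v v∉
  ... | inj₁ inside = rank-cong (λ X Y → trans (cong (_≡ᵇ 2) (trans (deg-mix G A X Y v)
            (trans (cong (degIn G A X v +_) (degIn-zero G (not ∘ A) Y v λ e i → cong not (inside e i))) (+-identityʳ _))))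
            (sym (∧-identityʳ (degIn G A X v ≡ᵇ 2))))
          (rank-∧₁ (λ X → degIn G A X v ≡ᵇ 2) (λ _ → true))
  ... | inj₂ outside = rank-cong (λ X Y → cong (_≡ᵇ 2) (trans (deg-mix G A X Y v)
            (cong (_+ degIn G (not ∘ A) Y v) (degIn-zero G A X v outside))))
          (rank-∧₁ (λ _ → true) (λ Y → degIn G (not ∘ A) Y v ≡ᵇ 2))

properIn-indep : ∀ {n m} (G : Graph (suc n) m) A i → (∀ e → incident G e (suc i) ≡ true → A e ≡ false) →
  Indep i (λ c → properIn G A (false ∷ c))
properIn-indep G A i outside c X = allF-cong pointwise
  where
  pointwise : ∀ e →
    not (A e ∧ lookup X e) ∨ same (lookup (false ∷ (c [ i ]≔ false)) (proj₁ (ends G e))) (lookup (false ∷ (c [ i ]≔ false)) (proj₂ (ends G e)))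
    ≡ not (A e ∧ lookup X e) ∨ same (lookup (false ∷ (c [ i ]≔ true)) (proj₁ (ends G e))) (lookup (false ∷ (c [ i ]≔ true)) (proj₂ (ends G e)))
  pointwise e with A e in Ae
  ... | false = refl
  ... | true with suc i ≟ proj₁ (ends G e) | suc i ≟ proj₂ (ends G e) | outside e
  ...   | yes _ | _ | o = contradiction (trans (sym Ae) (o refl)) λ ()
  ...   | no _ | yes _ | o = contradiction (trans (sym Ae) (o refl)) λ ()
  ...   | no p | no q | _ = cong₂ (λ a b → not (lookup X e) ∨ same a b) (unchanged _ p) (unchanged _ q)
    where
    unchanged : ∀ v → ¬ suc i ≡ v → lookup (false ∷ (c [ i ]≔ false)) v ≡ lookup (false ∷ (c [ i ]≔ true)) v
    unchanged zero _ = refl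
    unchanged (suc j) ne = trans (lookup∘update′ (λ eq → ne (cong suc (sym eq))) c _)
      (sym (lookup∘update′ (λ eq → ne (cong suc (sym eq))) c _))

rank-oddCuts : ∀ {n m} (G : Graph (suc n) m) b (B : Vec Bool n) (A : Fin m → Bool) → Separates G (b ∷ B) A →
  Rank (2 ^ ∣ B ∣) (λ X Y → oddCuts G (mix A X Y))
rank-oddCuts {n} G b B A sep = rank-cong
  (λ X Y → xorSum-cong n (λ c → proper-mix G A (false ∷ c) X Y))
  (rank-xorSum n B (λ c → properIn G A (false ∷ c)) (λ c → properIn G (not ∘ A) (false ∷ c)) indep)
  where
  indep : ∀ i → lookup B i ≡ false → Indep i (λ c → properIn G A (false ∷ c)) ⊎ Indep i (λ c → properIn G (not ∘ A) (false ∷ c))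
  indep i i∉ with sep (suc i) i∉
  ... | inj₁ inside = inj₂ (properIn-indep G (not ∘ A) i λ e inc → cong not (inside e inc))
  ... | inj₂ outside = inj₁ (properIn-indep G A i outside)

-- The 6 is three ways to split the degree of a border vertex times its two colours. Vertex `zero`
-- has a fixed colour, so only the tail of `B` counts for the cuts and the bound may be strict.
rank-hamiltonian : ∀ {n m} (G : Graph (suc n) m) (B : Vec Bool (suc n)) (A : Fin m → Bool) → Separates G B A →
  ∃[ r ] (r ≤ 6 ^ ∣ B ∣ × Rank r (λ X Y → hamiltonian G (mix A X Y)))
rank-hamiltonian G (b ∷ B) A sep = 3 ^ ∣ b ∷ B ∣ * 2 ^ ∣ B ∣ , rank≤ ,
  rank-∧ (rank-regular G (b ∷ B) A sep) (rank-oddCuts G b B A sep)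
  where
  ∣tail∣≤ : ∀ b → ∣ B ∣ ≤ ∣ b ∷ B ∣
  ∣tail∣≤ true = n≤1+n _
  ∣tail∣≤ false = ≤-refl
  6^ : ∀ k → 3 ^ k * 2 ^ k ≡ 6 ^ k
  6^ zero = refl
  6^ (suc k) = trans (regroup (3 ^ k) (2 ^ k)) (cong (6 *_) (6^ k))
    where
    regroup : ∀ x y → 3 * x * (2 * y) ≡ 6 * (x * y)
    regroup = solve-∀
  rank≤ : 3 ^ ∣ b ∷ B ∣ * 2 ^ ∣ B ∣ ≤ 6 ^ ∣ b ∷ B ∣
  rank≤ = ≤-trans (*-monoʳ-≤ (3 ^ ∣ b ∷ B ∣) (^-monoʳ-≤ 2 (∣tail∣≤ b))) (≤-reflexive (6^ ∣ b ∷ B ∣))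

-- Equivalence of the parity test with Hamiltonian cycles

module _ {n m : ℕ} (G : Graph n m) where

  joins-irrefl : ∀ {e v} → ¬ Joins G e v v
  joins-irrefl {e} (inj₁ eq) = <-irrefl (cong toℕ (trans (cong proj₁ eq) (sym (cong proj₂ eq)))) (ordered G e)
  joins-irrefl {e} (inj₂ eq) = <-irrefl (cong toℕ (trans (cong proj₁ eq) (sym (cong proj₂ eq)))) (ordered G e)

  joins-opposite : ∀ {e f u v} → ends G e ≡ (u , v) → ¬ ends G f ≡ (v , u)
  joins-opposite {e} {f} p q = <-asym
    (subst₂ (λ a b → toℕ a < toℕ b) (cong proj₁ p) (cong proj₂ p) (ordered G e))
    (subst₂ (λ a b → toℕ a < toℕ b) (cong proj₁ q) (cong proj₂ q) (ordered G f))

  joins-unique : ∀ {e f u v} → Joins G e u v → Joins G f u v → e ≡ f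
  joins-unique (inj₁ p) (inj₁ q) = simple G _ _ (trans p (sym q))
  joins-unique (inj₂ p) (inj₂ q) = simple G _ _ (trans p (sym q))
  joins-unique (inj₁ p) (inj₂ q) = contradiction q (joins-opposite p)
  joins-unique (inj₂ p) (inj₁ q) = contradiction p (joins-opposite q)

  joins-other : ∀ {e v w w′} → Joins G e v w → Joins G e v w′ → w ≡ w′
  joins-other (inj₁ p) (inj₁ q) = cong proj₂ (trans (sym p) q)
  joins-other (inj₂ p) (inj₂ q) = cong proj₁ (trans (sym p) q)
  joins-other (inj₁ p) (inj₂ q) = trans (cong proj₂ (trans (sym p) q)) (cong proj₁ (trans (sym p) q))
  joins-other (inj₂ p) (inj₁ q) = trans (cong proj₁ (trans (sym p) q)) (cong proj₂ (trans (sym p) q))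

  joins-sym : ∀ {e u v} → Joins G e u v → Joins G e v u
  joins-sym (inj₁ p) = inj₂ p
  joins-sym (inj₂ p) = inj₁ p

  incident⇒joins : ∀ {e v} → incident G e v ≡ true → ∃[ w ] Joins G e v w
  incident⇒joins {e} {v} inc with v ≟ proj₁ (ends G e) | v ≟ proj₂ (ends G e)
  ... | yes refl | _ = proj₂ (ends G e) , inj₁ refl
  ... | no _ | yes refl = proj₁ (ends G e) , inj₂ refl
  ... | no _ | no _ = contradiction inc λ ()

  joins⇒incident : ∀ {e v w} → Joins G e v w → incident G e v ≡ true
  joins⇒incident {e} {v} (inj₁ p) rewrite p | dec-true (v ≟ v) refl = refl
  joins⇒incident {e} {v} {w} (inj₂ p) rewrite p | dec-true (v ≟ v) refl with v ≟ w
  ... | yes _ = refl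
  ... | no _ = refl

∧-split : ∀ {a b} → a ∧ b ≡ true → a ≡ true × b ≡ true
∧-split {true} {true} _ = refl , refl

allF⁻ : ∀ {n} (f : Fin n → Bool) → allF f ≡ true → ∀ i → f i ≡ true
allF⁻ {suc n} f all zero = proj₁ (∧-split all)
allF⁻ {suc n} f all (suc i) = allF⁻ (f ∘ suc) (proj₂ (∧-split {f zero} all)) i

allF⁺ : ∀ {n} (f : Fin n → Bool) → (∀ i → f i ≡ true) → allF f ≡ true
allF⁺ {zero} f all = refl
allF⁺ {suc n} f all rewrite all zero = allF⁺ (f ∘ suc) (all ∘ suc)

count : ∀ {n} → (Fin n → Bool) → ℕ
count f = sumF (ind ∘ f)

count≡0⁻ : ∀ {n} (f : Fin n → Bool) → count f ≡ 0 → ∀ i → f i ≡ false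
count≡0⁻ {suc n} f eq i with f zero in f0
count≡0⁻ {suc n} f eq zero | false = f0
count≡0⁻ {suc n} f eq (suc i) | false = count≡0⁻ (f ∘ suc) eq i

count≡0⁺ : ∀ {n} (f : Fin n → Bool) → (∀ i → f i ≡ false) → count f ≡ 0
count≡0⁺ {zero} f all = refl
count≡0⁺ {suc n} f all rewrite all zero = count≡0⁺ (f ∘ suc) (all ∘ suc)

count≡1⁻ : ∀ {n} (f : Fin n → Bool) → count f ≡ 1 → ∃[ i ] (f i ≡ true × (∀ j → f j ≡ true → j ≡ i))
count≡1⁻ {suc n} f eq with f zero in f0
... | true = zero , f0 , λ { zero _ → refl ; (suc j) fj → contradiction (trans (sym fj) (count≡0⁻ (f ∘ suc) (cong pred eq) j)) λ () }
... | false with count≡1⁻ (f ∘ suc) eq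
...   | i , fi , uniq = suc i , fi , λ { zero fz → contradiction (trans (sym fz) f0) λ () ; (suc j) fj → cong suc (uniq j fj) }

count≡1⁺ : ∀ {n} (f : Fin n → Bool) i → f i ≡ true → (∀ j → f j ≡ true → j ≡ i) → count f ≡ 1
count≡1⁺ f zero fi uniq rewrite fi = cong suc (count≡0⁺ (f ∘ suc) off)
  where
  off : ∀ j → f (suc j) ≡ false
  off j with f (suc j) in fj
  ... | true = contradiction (uniq (suc j) fj) λ ()
  ... | false = refl
count≡1⁺ f (suc i) fi uniq with f zero in f0
... | true = contradiction (uniq zero f0) λ ()
... | false = count≡1⁺ (f ∘ suc) i fi λ j fj → suc-injective (uniq (suc j) fj)

ExactlyTwo : ∀ {n} → (Fin n → Bool) → Set
ExactlyTwo f = ∃[ i ] ∃[ j ] (¬ i ≡ j × f i ≡ true × f j ≡ true × (∀ k → f k ≡ true → k ≡ i ⊎ k ≡ j))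

count≡2⁻ : ∀ {n} (f : Fin n → Bool) → count f ≡ 2 → ExactlyTwo f
count≡2⁻ {suc n} f eq with f zero in f0
... | true with count≡1⁻ (f ∘ suc) (cong pred eq)
...   | i , fi , uniq = zero , suc i , (λ ()) , f0 , fi , λ { zero _ → inj₁ refl ; (suc k) fk → inj₂ (cong suc (uniq k fk)) }
count≡2⁻ {suc n} f eq | false with count≡2⁻ (f ∘ suc) eq
... | i , j , i≢j , fi , fj , cover = suc i , suc j , i≢j ∘ suc-injective , fi , fj ,
  λ { zero fz → contradiction (trans (sym fz) f0) λ () ; (suc k) fk → Sum.map (cong suc) (cong suc) (cover k fk) }

count≡2⁺ : ∀ {n} (f : Fin n → Bool) → ExactlyTwo f → count f ≡ 2
count≡2⁺ f (zero , zero , i≢j , _) = contradiction refl i≢j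
count≡2⁺ f (zero , suc j , i≢j , fi , fj , cover) rewrite fi =
  cong suc (count≡1⁺ (f ∘ suc) j fj λ k fk → [ (λ ()) , suc-injective ]′ (cover (suc k) fk))
count≡2⁺ f (suc i , zero , i≢j , fi , fj , cover) rewrite fj =
  cong suc (count≡1⁺ (f ∘ suc) i fi λ k fk → [ suc-injective , (λ ()) ]′ (cover (suc k) fk))
count≡2⁺ f (suc i , suc j , i≢j , fi , fj , cover) with f zero in f0
... | true = contradiction (cover zero f0) λ { (inj₁ ()) ; (inj₂ ()) }
... | false = count≡2⁺ (f ∘ suc) (i , j , i≢j ∘ cong suc , fi , fj , λ k fk → Sum.map suc-injective suc-injective (cover (suc k) fk))

xorSum-shift : ∀ {n} (u : Vec Bool n) f → xorSum n (λ c → f (Vec.zipWith _xor_ u c)) ≡ xorSum n f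
xorSum-shift [] f = refl
xorSum-shift (false ∷ u) f = cong₂ _xor_ (xorSum-shift u (f ∘ (false ∷_))) (xorSum-shift u (f ∘ (true ∷_)))
xorSum-shift (true ∷ u) f = trans (cong₂ _xor_ (xorSum-shift u (f ∘ (true ∷_))) (xorSum-shift u (f ∘ (false ∷_))))
  (xor-comm _ (xorSum _ (f ∘ (false ∷_))))

-- Translation by a nonzero `u` pairs the vectors, and the two values of each pair cancel.
xorSum-invariant : ∀ {n} (u : Vec Bool n) i f → lookup u i ≡ true → (∀ c → f (Vec.zipWith _xor_ u c) ≡ f c) →
  xorSum n f ≡ false
xorSum-invariant {suc n} (true ∷ u) i f ui inv = trans
  (cong (_xor xorSum n (f ∘ (true ∷_))) (trans (xorSum-cong n λ c → sym (inv (false ∷ c))) (xorSum-shift u (f ∘ (true ∷_)))))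
  (xor-same (xorSum n (f ∘ (true ∷_))))
xorSum-invariant (false ∷ u) (suc i) f ui inv =
  cong₂ _xor_ (xorSum-invariant u i (f ∘ (false ∷_)) ui (inv ∘ (false ∷_)))
              (xorSum-invariant u i (f ∘ (true ∷_)) ui (inv ∘ (true ∷_)))

xorSum-zero : ∀ n (f : Vec Bool n → Bool) → (∀ c → f c ≡ false) → xorSum n f ≡ false
xorSum-zero zero f z = z []
xorSum-zero (suc n) f z = cong₂ _xor_ (xorSum-zero n (f ∘ (false ∷_)) (z ∘ (false ∷_))) (xorSum-zero n (f ∘ (true ∷_)) (z ∘ (true ∷_)))

xorSum-single : ∀ n (f : Vec Bool n → Bool) → f (Vec.replicate n false) ≡ true →
  (∀ c → f c ≡ true → ∀ i → lookup c i ≡ false) → xorSum n f ≡ true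
xorSum-single zero f on only = on
xorSum-single (suc n) f on only = cong₂ _xor_
  (xorSum-single n (f ∘ (false ∷_)) on λ c fc i → only (false ∷ c) fc (suc i))
  (xorSum-zero n (f ∘ (true ∷_)) off)
  where
  off : ∀ c → f (true ∷ c) ≡ false
  off c with f (true ∷ c) in fc
  ... | true = contradiction (only (true ∷ c) fc zero) λ ()
  ... | false = refl

injective⇒surjective : ∀ {n} (σ : Fin n → Fin n) → Injective _≡_ _≡_ σ → ∀ v → ∃[ i ] σ i ≡ v
injective⇒surjective {n} σ inj v with any? (λ i → σ i ≟ v)
... | yes found = found
... | no none with pigeonhole (n<1+n n) f
  where
  f : Fin (suc n) → Fin n
  f zero = v
  f (suc i) = σ i
...   | zero , suc j , _ , eq = contradiction (j , sym eq) none
...   | suc i , suc j , i<j , eq = contradiction (cong toℕ (inj eq)) (<⇒≢ (s≤s⁻¹ i<j))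

-- In a graph where each vertex has two neighbours, the walk from `zero` that never turns back
-- traces the cycle through `zero`. Its vertex set is closed under adjacency.
module Walk {n : ℕ} (R : Fin (suc n) → Fin (suc n) → Set)
  (R-sym : ∀ {u v} → R u v → R v u) (R-irrefl : ∀ {v} → ¬ R v v)
  (two : ∀ v → ∃[ a ] ∃[ b ] (¬ a ≡ b × R v a × R v b × (∀ {w} → R v w → w ≡ a ⊎ w ≡ b))) where

  V : Set
  V = Fin (suc n)

  next : ∀ (u v : V) → ∃[ w ] (R v w × ¬ w ≡ u)
  next u v with two v
  ... | a , b , a≢b , Ra , Rb , _ with a ≟ u
  ...   | yes refl = b , Rb , a≢b ∘ sym
  ...   | no a≢u = a , Ra , a≢u

  steps : ℕ → V × V
  steps zero = zero , proj₁ (two zero)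
  steps (suc i) = proj₂ (steps i) , proj₁ (next (proj₁ (steps i)) (proj₂ (steps i)))

  x : ℕ → V
  x i = proj₁ (steps i)

  step-R : ∀ i → R (x i) (x (suc i))
  step-R zero = proj₁ (proj₂ (proj₂ (proj₂ (two zero))))
  step-R (suc i) = proj₁ (proj₂ (next (proj₁ (steps i)) (proj₂ (steps i))))

  no-turn : ∀ i → ¬ x (2 + i) ≡ x i
  no-turn i = proj₂ (proj₂ (next (proj₁ (steps i)) (proj₂ (steps i))))

  only-neighbours : ∀ {v a b w} → R v a → R v b → ¬ a ≡ b → R v w → w ≡ a ⊎ w ≡ b
  only-neighbours {v} Ra Rb a≢b Rw with two v
  ... | p , q , _ , _ , _ , cover with cover Ra | cover Rb | cover Rw
  ...   | inj₁ refl | inj₁ refl | _ = contradiction refl a≢b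
  ...   | inj₂ refl | inj₂ refl | _ = contradiction refl a≢b
  ...   | inj₁ refl | inj₂ refl | w = w
  ...   | inj₂ refl | inj₁ refl | w = Sum.swap w

  Distinct : ℕ → Set
  Distinct r = ∀ {i j} → i < j → j ≤ r → ¬ x i ≡ x j

  Return : Set
  Return = ∃[ r ] (Distinct r × (∃[ j ] (j ≤ r × x (suc r) ≡ x j)))

  distinct⇒injective : ∀ {r k} → Distinct r → (f : Fin k → ℕ) → (∀ i → f i ≤ r) → Injective _≡_ _≡_ f →
    Injective _≡_ _≡_ (x ∘ f)
  distinct⇒injective dis f f≤ inj {i} {j} eq with <-cmp (f i) (f j)
  ... | tri< lt _ _ = contradiction eq (dis lt (f≤ j))
  ... | tri≈ _ e _ = inj e
  ... | tri> _ _ gt = contradiction (sym eq) (dis gt (f≤ i))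

  -- The fuel runs out only once the walk has more distinct vertices than the graph, which the
  -- pigeonhole principle forbids.
  find-return : ∀ fuel r → suc n ≤ r + fuel → Distinct r → Return
  find-return zero r le dis with pigeonhole (n<1+n (suc n)) (x ∘ toℕ)
  ... | i , j , i<j , eq = contradiction eq
    (dis i<j (≤-trans (s≤s⁻¹ (toℕ<n j)) (≤-trans le (≤-reflexive (+-identityʳ r)))))
  find-return (suc fuel) r le dis with any? (λ (j : Fin (suc r)) → x (suc r) ≟ x (toℕ j))
  ... | yes (j , eq) = r , dis , toℕ j , s≤s⁻¹ (toℕ<n j) , eq
  ... | no new = find-return fuel (suc r) (≤-trans le (≤-reflexive (+-suc r fuel))) dis′
    where
    dis′ : Distinct (suc r)
    dis′ {i} {j} i<j j≤ with m≤n⇒m<n∨m≡n j≤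
    ... | inj₁ (s≤s j≤r) = dis i<j j≤r
    ... | inj₂ refl = λ eq → new (fromℕ< i<j , trans (sym eq) (cong x (sym (toℕ-fromℕ< i<j))))

  -- An inner vertex `x (suc j)` already has its two neighbours `x j` and `x (2 + j)` on the walk.
  -- Closing there would make `x r` one of them, which means a repetition or, if `r` is `2 + j`, a
  -- turn back. If `r` is `suc j`, it would be a loop.
  closes-at : ∀ {r} → Distinct r → ∀ j → j ≤ r → x (suc r) ≡ x j → j ≡ 0
  closes-at _ zero _ _ = refl
  closes-at {r} distinct (suc j) j≤r eq with m≤n⇒m<n∨m≡n j≤r
  ... | inj₂ refl = contradiction (subst (R (x r)) eq (step-R r)) R-irrefl
  ... | inj₁ j<r with only-neighbours (R-sym (step-R j)) (step-R (suc j)) (no-turn j ∘ sym)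
                        (R-sym (subst (R (x r)) eq (step-R r)))
  ...   | inj₁ eq′ = contradiction (sym eq′) (distinct (<-trans (n<1+n j) j<r) ≤-refl)
  ...   | inj₂ eq′ with m≤n⇒m<n∨m≡n j<r
  ...     | inj₁ lt = contradiction (sym eq′) (distinct lt ≤-refl)
  ...     | inj₂ refl = contradiction eq (no-turn (suc j))

  abstract
    the-return : Return
    the-return = find-return (suc n) 0 ≤-refl λ { () z≤n }

  r : ℕ
  r = proj₁ the-return

  distinct : Distinct r
  distinct = proj₁ (proj₂ the-return)

  closes : x (suc r) ≡ x 0
  closes = let j , j≤r , eq = proj₂ (proj₂ the-return) in trans eq (cong x (closes-at distinct j j≤r eq))

  2≤r : 2 ≤ r
  2≤r = go r closes
    where
    go : ∀ r → x (suc r) ≡ x 0 → 2 ≤ r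
    go 0 eq = contradiction (subst (R (x 0)) eq (step-R 0)) R-irrefl
    go 1 eq = contradiction eq (no-turn 0)
    go (suc (suc r)) eq = s≤s (s≤s z≤n)

  Next : ℕ → ℕ → Set
  Next i j = (j ≡ suc i) ⊎ (i ≡ r × j ≡ 0)

  neighbours-on-walk : ∀ {i w} → i ≤ r → R (x i) w →
    ∃[ j ] (j ≤ r × x j ≡ w × (Next i j ⊎ Next j i))
  neighbours-on-walk {zero} i≤r Rw
    with only-neighbours (step-R 0) (R-sym (subst (R (x r)) closes (step-R r))) (distinct 2≤r ≤-refl) Rw
  ... | inj₁ refl = 1 , <⇒≤ 2≤r , refl , inj₁ (inj₁ refl)
  ... | inj₂ refl = r , ≤-refl , refl , inj₂ (inj₂ (refl , refl))
  neighbours-on-walk {suc i} i≤r Rw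
    with only-neighbours (R-sym (step-R i)) (step-R (suc i)) (no-turn i ∘ sym) Rw
  ... | inj₁ refl = i , <⇒≤ i≤r , refl , inj₂ (inj₁ refl)
  ... | inj₂ refl with m≤n⇒m<n∨m≡n i≤r
  ...   | inj₁ lt = 2 + i , lt , refl , inj₁ (inj₁ refl)
  ...   | inj₂ eq = 0 , z≤n , trans (sym closes) (cong (x ∘ suc) (sym eq)) , inj₁ (inj₂ (eq , refl))

  visited? : ∀ v → Dec (∃[ i ] x (toℕ {suc r} i) ≡ v)
  visited? v = any? (λ i → x (toℕ i) ≟ v)

  visited-closed : ∀ {v w} → R v w → ∃[ i ] x (toℕ {suc r} i) ≡ v → ∃[ i ] x (toℕ {suc r} i) ≡ w
  visited-closed Rvw (i , refl) with neighbours-on-walk (s≤s⁻¹ (toℕ<n i)) Rvw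
  ... | j , j≤r , eq , _ = fromℕ< (s≤s j≤r) , trans (cong x (toℕ-fromℕ< (s≤s j≤r))) eq

  visited : V → Bool
  visited v = does (visited? v)

  visited-cong : ∀ {v w} → R v w → visited v ≡ visited w
  visited-cong {v} {w} Rvw = does-⇔ (mk⇔ (visited-closed Rvw) (visited-closed (R-sym Rvw))) (visited? v) (visited? w)

  r≤n : r ≤ n
  r≤n = s≤s⁻¹ (injective⇒≤ (distinct⇒injective distinct toℕ (λ i → s≤s⁻¹ (toℕ<n i)) toℕ-injective))

  unvisited : r < n → ∃[ v ] visited v ≡ false
  unvisited r<n with any? (λ v → visited v ≟ᵇ false)
  ... | yes found = found
  ... | no none = absurd (pigeonhole (s≤s r<n) (proj₁ ∘ index))
    where
    index : ∀ v → ∃[ i ] x (toℕ {suc r} i) ≡ v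
    index v with visited? v
    ... | yes p = p
    ... | no ¬p = contradiction (v , dec-false (visited? v) ¬p) none
    absurd : (∃[ u ] ∃[ v ] (toℕ {suc n} u < toℕ {suc n} v × proj₁ (index u) ≡ proj₁ (index v))) → ∃[ v ] visited v ≡ false
    absurd (u , v , u<v , eq) = contradiction
      (cong toℕ (trans (sym (proj₂ (index u))) (trans (cong (x ∘ toℕ) eq) (proj₂ (index v))))) (<⇒≢ u<v)

Adj : ∀ {n m} → Graph n m → Subset m → Fin n → Fin n → Set
Adj G Z u v = ∃[ e ] (lookup Z e ≡ true × Joins G e u v)

adj-sym : ∀ {n m} (G : Graph n m) Z {u v} → Adj G Z u v → Adj G Z v u
adj-sym G Z (e , e∈ , joins) = e , e∈ , joins-sym G joins

adj-irrefl : ∀ {n m} (G : Graph n m) Z {v} → ¬ Adj G Z v v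
adj-irrefl G Z (_ , _ , joins) = joins-irrefl G joins

regular⇒two : ∀ {n m} (G : Graph n m) Z → regular G Z ≡ true → ∀ v →
  ∃[ a ] ∃[ b ] (¬ a ≡ b × Adj G Z v a × Adj G Z v b × (∀ {w} → Adj G Z v w → w ≡ a ⊎ w ≡ b))
regular⇒two G Z reg v with count≡2⁻ (λ e → lookup Z e ∧ incident G e v) deg≡2
  where
  deg≡2 : deg G Z v ≡ 2
  deg≡2 = ≡ᵇ⇒≡ _ _ (subst T (sym (allF⁻ _ reg v)) _)
... | e , f , e≢f , e∈ , f∈ , cover with incident⇒joins G (proj₂ (∧-split {lookup Z e} e∈)) | incident⇒joins G (proj₂ (∧-split {lookup Z f} f∈))
...   | a , ja | b , jb = a , b , (λ { refl → e≢f (joins-unique G ja jb) }) ,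
        (e , proj₁ (∧-split e∈) , ja) , (f , proj₁ (∧-split f∈) , jb) , classify
  where
  classify : ∀ {w} → Adj G Z v w → w ≡ a ⊎ w ≡ b
  classify (g , g∈ , jg) with cover g (cong₂ _∧_ g∈ (joins⇒incident G jg))
  ... | inj₁ refl = inj₁ (joins-other G jg ja)
  ... | inj₂ refl = inj₂ (joins-other G jg jb)

-- Flipping the colours of all vertices with `side` false creates no crossing, leaves `zero` on its
-- fixed side and changes at least one colour. The uncrossed cuts therefore cancel in pairs.
oddCuts-split : ∀ {n m} (G : Graph (suc n) m) Z (side : Fin (suc n) → Bool) → side zero ≡ true →
  (∀ {u v} → Adj G Z u v → side u ≡ side v) → (∃[ v ] side v ≡ false) → oddCuts G Z ≡ false
oddCuts-split G Z side side0 closed (zero , off) = contradiction (trans (sym side0) off) λ ()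
oddCuts-split {n} G Z side side0 closed (suc i , off) =
  xorSum-invariant u i (λ c → proper G (false ∷ c) Z) (trans (lookup∘tabulate _ i) (cong not off)) invariant
  where
  u : Vec Bool n
  u = Vec.tabulate (λ i → not (side (suc i)))
  lookup-u : ∀ v → lookup (false ∷ u) v ≡ not (side v)
  lookup-u zero = sym (cong not side0)
  lookup-u (suc i) = lookup∘tabulate _ i
  cancel : ∀ a b c → same (a xor b) (a xor c) ≡ same b c
  cancel true true true = refl
  cancel true true false = refl
  cancel true false true = refl
  cancel true false false = refl
  cancel false b c = refl
  invariant : ∀ c → proper G (false ∷ Vec.zipWith _xor_ u c) Z ≡ proper G (false ∷ c) Z
  invariant c = allF-cong pointwise
    where
    shifted : ∀ v → lookup (false ∷ Vec.zipWith _xor_ u c) v ≡ not (side v) xor lookup (false ∷ c) v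
    shifted v = trans (lookup-zipWith _xor_ v (false ∷ u) (false ∷ c)) (cong (_xor lookup (false ∷ c) v) (lookup-u v))
    pointwise : ∀ e → not (lookup Z e) ∨ same (lookup (false ∷ Vec.zipWith _xor_ u c) (proj₁ (ends G e)))
                                              (lookup (false ∷ Vec.zipWith _xor_ u c) (proj₂ (ends G e)))
                    ≡ not (lookup Z e) ∨ same (lookup (false ∷ c) (proj₁ (ends G e))) (lookup (false ∷ c) (proj₂ (ends G e)))
    pointwise e with lookup Z e in Ze
    ... | false = refl
    ... | true = trans (cong₂ same (shifted (proj₁ (ends G e)))
        (trans (shifted (proj₂ (ends G e))) (cong (λ s → not s xor lookup (false ∷ c) (proj₂ (ends G e))) (sym (closed (e , Ze , inj₁ refl))))))
      (cancel (not (side (proj₁ (ends G e)))) _ _)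

-- The closed walk gives the cyclic order. If it missed a vertex, its vertex set would be a `side`
-- that makes the number of cuts even.
hamiltonian⇒HC : ∀ {n m} (G : Graph (suc n) m) Z → hamiltonian G Z ≡ true → HC G Z
hamiltonian⇒HC {n} G Z ham = s≤s (≤-trans 2≤r r≤n) , σ , σ-injective , consecutive , covered , chosen
  where
  split = ∧-split {regular G Z} ham
  open Walk (Adj G Z) (adj-sym G Z) (adj-irrefl G Z) (regular⇒two G Z (proj₁ split))
  r≡n : r ≡ n
  r≡n with m≤n⇒m<n∨m≡n r≤n
  ... | inj₂ eq = eq
  ... | inj₁ lt = contradiction (trans (sym (proj₂ split))
        (oddCuts-split G Z visited (dec-true (visited? zero) (zero , refl)) visited-cong (unvisited lt))) λ ()
  σ : Fin (suc n) → Fin (suc n)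
  σ i = x (toℕ i)
  σ-injective : Injective _≡_ _≡_ σ
  σ-injective = distinct⇒injective distinct toℕ (λ i → ≤-trans (s≤s⁻¹ (toℕ<n i)) (≤-reflexive (sym r≡n))) toℕ-injective
  next⇒adj : ∀ {i j} → Next i j → Adj G Z (x i) (x j)
  next⇒adj {i} (inj₁ refl) = step-R i
  next⇒adj (inj₂ (refl , refl)) = subst (Adj G Z (x r)) closes (step-R r)
  succ⇒next : ∀ {i j : Fin (suc n)} → CycSucc i j → Next (toℕ i) (toℕ j)
  succ⇒next (inj₁ eq) = inj₁ eq
  succ⇒next (inj₂ (eq , eq′)) = inj₂ (trans (suc-injectiveℕ eq) (sym r≡n) , eq′)
  next⇒succ : ∀ {i j : Fin (suc n)} → Next (toℕ i) (toℕ j) → CycSucc i j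
  next⇒succ (inj₁ eq) = inj₁ eq
  next⇒succ (inj₂ (eq , eq′)) = inj₂ (cong suc (trans eq r≡n) , eq′)
  succ⇒adj : ∀ {i j} → CycSucc i j → Adj G Z (σ i) (σ j)
  succ⇒adj s = next⇒adj (succ⇒next s)
  consecutive : ∀ i j → CycSucc i j → ∃[ e ] Joins G e (σ i) (σ j)
  consecutive i j s = let e , _ , joins = succ⇒adj s in e , joins
  chosen : ∀ e i j → CycSucc i j → Joins G e (σ i) (σ j) → e ∈ˢ Z
  chosen e i j s joins = let f , f∈ , joins′ = succ⇒adj s in
    lookup⇒[]= e Z (trans (cong (lookup Z) (joins-unique G joins joins′)) f∈)
  covered : ∀ e → e ∈ˢ Z → ∃[ i ] ∃[ j ] (CycSucc i j × Joins G e (σ i) (σ j))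
  covered e e∈ = from (injective⇒surjective σ σ-injective (proj₁ (ends G e)))
    where
    from : ∃[ i ] σ i ≡ proj₁ (ends G e) → ∃[ i ] ∃[ j ] (CycSucc i j × Joins G e (σ i) (σ j))
    from (i , eq) = result (neighbours-on-walk (≤-trans (s≤s⁻¹ (toℕ<n i)) (≤-reflexive (sym r≡n)))
        (subst (λ v → Adj G Z v (proj₂ (ends G e))) (sym eq) (e , []=⇒lookup e∈ , inj₁ refl)))
      where
      result : ∃[ j ] (j ≤ r × x j ≡ proj₂ (ends G e) × (Next (toℕ i) j ⊎ Next j (toℕ i))) →
        ∃[ i ] ∃[ j ] (CycSucc i j × Joins G e (σ i) (σ j))
      result (j , j≤r , eq′ , nxt) = orient nxt
        where
        j< : j < suc n
        j< = s≤s (≤-trans j≤r r≤n)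
        jF = fromℕ< j<
        joins : Joins G e (σ i) (σ jF)
        joins = inj₁ (cong₂ _,_ (sym eq) (sym (trans (cong x (toℕ-fromℕ< j<)) eq′)))
        orient : Next (toℕ i) j ⊎ Next j (toℕ i) → ∃[ i ] ∃[ j ] (CycSucc i j × Joins G e (σ i) (σ j))
        orient (inj₁ s) = i , jF , next⇒succ (subst (Next (toℕ i)) (sym (toℕ-fromℕ< j<)) s) , joins
        orient (inj₂ s) = jF , i , next⇒succ (subst (λ k → Next k (toℕ i)) (sym (toℕ-fromℕ< j<)) s) , joins-sym G joins

cycSucc-exists : ∀ {n} (i : Fin (suc n)) → ∃[ j ] CycSucc i j
cycSucc-exists {n} i with m≤n⇒m<n∨m≡n (toℕ<n i)
... | inj₁ lt = fromℕ< lt , inj₁ (toℕ-fromℕ< lt)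
... | inj₂ eq = zero , inj₂ (eq , refl)

cycPred-exists : ∀ {n} (j : Fin (suc n)) → ∃[ i ] CycSucc i j
cycPred-exists {n} zero = fromℕ< (n<1+n n) , inj₂ (cong suc (toℕ-fromℕ< (n<1+n n)) , refl)
cycPred-exists (suc j) = inject₁ j , inj₁ (cong suc (sym (toℕ-inject₁ j)))

cycSucc-unique : ∀ {n} {i j k : Fin n} → CycSucc i j → CycSucc i k → j ≡ k
cycSucc-unique (inj₁ p) (inj₁ q) = toℕ-injective (trans p (sym q))
cycSucc-unique (inj₂ (_ , p)) (inj₂ (_ , q)) = toℕ-injective (trans p (sym q))
cycSucc-unique {j = j} (inj₁ p) (inj₂ (q , _)) = contradiction (trans p q) (<⇒≢ (toℕ<n j))
cycSucc-unique {k = k} (inj₂ (q , _)) (inj₁ p) = contradiction (trans p q) (<⇒≢ (toℕ<n k))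

cycPred-unique : ∀ {n} {i j k : Fin n} → CycSucc i k → CycSucc j k → i ≡ j
cycPred-unique (inj₁ p) (inj₁ q) = toℕ-injective (suc-injectiveℕ (trans (sym p) q))
cycPred-unique (inj₂ (p , _)) (inj₂ (q , _)) = toℕ-injective (suc-injectiveℕ (trans p (sym q)))
cycPred-unique (inj₁ p) (inj₂ (_ , q)) = contradiction (trans (sym p) q) λ ()
cycPred-unique (inj₂ (_ , q)) (inj₁ p) = contradiction (trans (sym p) q) λ ()

-- This is what `3 ≤ n` gives: the edges from a vertex to its successor and to its predecessor are
-- distinct, so the degree is 2 and not 1.
cycSucc-asym : ∀ {n} {i j : Fin n} → 3 ≤ n → CycSucc i j → ¬ CycSucc j i
cycSucc-asym 3≤n (inj₁ p) (inj₁ q) = <-asym (≤-reflexive (sym p)) (≤-reflexive (sym q))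
cycSucc-asym 3≤n (inj₁ p) (inj₂ (q , q′)) rewrite q′ | p = contradiction 3≤n (<⇒≱ (≤-reflexive (cong suc (sym q))))
cycSucc-asym 3≤n (inj₂ (q , q′)) (inj₁ p) rewrite q′ | p = contradiction 3≤n (<⇒≱ (≤-reflexive (cong suc (sym q))))
cycSucc-asym 3≤n (inj₂ (q , q′)) (inj₂ (p , p′)) rewrite p′ = contradiction 3≤n (<⇒≱ (s≤s (≤-trans (≤-reflexive (sym q)) (n≤1+n 1))))

-- A colouring crossed by no edge is constant along the cycle, and the fixed colour of `zero` leaves
-- just one: an odd number of cuts.
HC⇒hamiltonian : ∀ {n m} (G : Graph (suc n) m) Z → HC G Z → hamiltonian G Z ≡ true
HC⇒hamiltonian {n} {m} G Z (3≤n , σ , inj , consecutive , covered , chosen) = cong₂ _∧_ is-regular odd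
  where
  surj = injective⇒surjective σ inj
  succ⇒adj : ∀ {i j} → CycSucc i j → Adj G Z (σ i) (σ j)
  succ⇒adj {i} {j} s with consecutive i j s
  ... | e , joins = e , []=⇒lookup (chosen e i j s joins) , joins
  two-edges : ∀ v → ExactlyTwo (λ e → lookup Z e ∧ incident G e v)
  two-edges v with surj v
  ... | i , refl with cycSucc-exists i | cycPred-exists i
  ...   | j , i→j | k , k→i with succ⇒adj i→j | succ⇒adj k→i
  ...     | e , e∈ , je | f , f∈ , jf = e , f , e≢f ,
              cong₂ _∧_ e∈ (joins⇒incident G je) , cong₂ _∧_ f∈ (joins⇒incident G (joins-sym G jf)) , classify
    where
    e≢f : ¬ e ≡ f
    e≢f refl with inj (joins-other G je (joins-sym G jf))
    ... | refl = cycSucc-asym 3≤n i→j k→i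
    classify : ∀ g → lookup Z g ∧ incident G g (σ i) ≡ true → g ≡ e ⊎ g ≡ f
    classify g g∈ with covered g (lookup⇒[]= g Z (proj₁ (∧-split g∈)))
    ... | a , b , a→b , jg with incident⇒joins G (proj₂ (∧-split {lookup Z g} g∈))
    ...   | w , jw with jg | jw
    ...     | p | q with endpoint p q
      where
      endpoint : ∀ {v} → Joins G g (σ a) (σ b) → Joins G g v w → v ≡ σ a ⊎ v ≡ σ b
      endpoint (inj₁ p) (inj₁ q) = inj₁ (cong proj₁ (trans (sym q) p))
      endpoint (inj₁ p) (inj₂ q) = inj₂ (cong proj₂ (trans (sym q) p))
      endpoint (inj₂ p) (inj₁ q) = inj₂ (cong proj₁ (trans (sym q) p))
      endpoint (inj₂ p) (inj₂ q) = inj₁ (cong proj₂ (trans (sym q) p))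
    ...       | inj₁ eq with inj eq
    ...         | refl with cycSucc-unique a→b i→j
    ...           | refl = inj₁ (joins-unique G jg je)
    classify g g∈ | a , b , a→b , jg | w , jw | p | q | inj₂ eq with inj eq
    ...         | refl with cycPred-unique a→b k→i
    ...           | refl = inj₂ (joins-unique G jg jf)
  is-regular : regular G Z ≡ true
  is-regular = allF⁺ _ λ v → cong (_≡ᵇ 2) (count≡2⁺ _ (two-edges v))
  odd : oddCuts G Z ≡ true
  odd = xorSum-single n (λ c → proper G (false ∷ c) Z) (allF⁺ _ uncut) connected
    where
    uncut : ∀ e → not (lookup Z e) ∨ same (lookup (false ∷ Vec.replicate n false) (proj₁ (ends G e)))
                                          (lookup (false ∷ Vec.replicate n false) (proj₂ (ends G e))) ≡ true
    uncut e rewrite lookup-replicate (proj₁ (ends G e)) false | lookup-replicate (proj₂ (ends G e)) false with lookup Z e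
    ... | true = refl
    ... | false = refl
    same⇒≡ : ∀ a b → same a b ≡ true → a ≡ b
    same⇒≡ true true _ = refl
    same⇒≡ false false _ = refl
    connected : ∀ c → proper G (false ∷ c) Z ≡ true → ∀ i → lookup c i ≡ false
    connected c prop i with surj (suc i) | surj zero
    ... | a , eqa | b , eqb = trans (cong (lookup (false ∷ c)) (sym eqa))
          (trans (constant a) (trans (sym (constant b)) (cong (lookup (false ∷ c)) eqb)))
      where
      adj-same : ∀ {u v} → Adj G Z u v → lookup (false ∷ c) u ≡ lookup (false ∷ c) v
      adj-same (e , e∈ , joins) with allF⁻ _ prop e | joins
      ... | ok | inj₁ eq rewrite e∈ | eq = same⇒≡ _ _ ok
      ... | ok | inj₂ eq rewrite e∈ | eq = sym (same⇒≡ _ _ ok)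
      constant : ∀ a → lookup (false ∷ c) (σ a) ≡ lookup (false ∷ c) (σ zero)
      constant = <-weakInduction _ refl λ j IH →
        trans (sym (adj-same (succ⇒adj {inject₁ j} {suc j} (inj₁ (cong suc (sym (toℕ-inject₁ j))))))) IH

-- Balancing tree decompositions

∣⊥∣ : ∀ k → ∣ Vec.replicate k false ∣ ≡ 0
∣⊥∣ zero = refl
∣⊥∣ (suc k) = ∣⊥∣ k

∣∪∣≤ : ∀ {k} (p q : Subset k) → ∣ p ∪ q ∣ ≤ ∣ p ∣ + ∣ q ∣
∣∪∣≤ [] [] = z≤n
∣∪∣≤ (true ∷ p) (true ∷ q) = s≤s (≤-trans (∣∪∣≤ p q) (+-monoʳ-≤ ∣ p ∣ (n≤1+n ∣ q ∣)))
∣∪∣≤ (true ∷ p) (false ∷ q) = s≤s (∣∪∣≤ p q)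
∣∪∣≤ (false ∷ p) (true ∷ q) = ≤-trans (s≤s (∣∪∣≤ p q)) (≤-reflexive (sym (+-suc ∣ p ∣ ∣ q ∣)))
∣∪∣≤ (false ∷ p) (false ∷ q) = ∣∪∣≤ p q

j+0≤ : ∀ {j p} → j ≤ p → j + 0 ≤ p
j+0≤ {j} le = ≤-trans (≤-reflexive (+-identityʳ j)) le

-- `p` is half the budget and `j` counts leaves already set aside. If the branch `a` exceeds half,
-- `j` and the sibling branch `b` fit together into the other half.
half-left : ∀ {p} j a b → p < a → j + (a + b) ≤ p + p → j + b ≤ p
half-left {p} j a b p<a le = +-cancelˡ-≤ p (j + b) p (begin
  p + (j + b) ≤⟨ +-monoˡ-≤ (j + b) (<⇒≤ p<a) ⟩
  a + (j + b) ≡⟨ swap₃ a j b ⟩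
  j + (a + b) ≤⟨ le ⟩
  p + p ∎)
  where
  open ≤-Reasoning
  swap₃ : ∀ a j b → a + (j + b) ≡ j + (a + b)
  swap₃ = solve-∀

-- Defined by recursion so that `double (suc d)` unfolds to the two levels spent each time the
-- number of leaves is halved.
double : ℕ → ℕ
double zero = 0
double (suc d) = 2 + double d

2^suc : ∀ d → 2 ^ suc d ≡ 2 ^ d + 2 ^ d
2^suc d = cong (2 ^ d +_) (+-identityʳ (2 ^ d))

module _ {n m : ℕ} (G : Graph n m) where

  Edges : Set
  Edges = Fin m → Bool

  Small : ℕ → Edges → Set
  Small s A = ∃[ B ] (∣ B ∣ ≤ s × Separates G B A)

  ∅ : Edges
  ∅ _ = false

  _∖_ : Edges → Edges → Edges
  (A ∖ B) e = A e ∧ not (B e)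

  Covers : Edges → Edges → Edges → Set
  Covers A A₁ A₂ = ∀ e → A e ≡ true → A₁ e ≡ true ⊎ A₂ e ≡ true

  small-∅ : ∀ {s A} → (∀ e → A e ≡ false) → Small s A
  small-∅ {s} empty = Vec.replicate n false , ≤-trans (≤-reflexive (∣⊥∣ n)) z≤n , λ v _ → inj₂ λ e _ → empty e

  small-mono : ∀ {s s′ A} → s ≤ s′ → Small s A → Small s′ A
  small-mono le (B , B≤ , sep) = B , ≤-trans B≤ le , sep

  -- A vertex off both borders lies wholly inside or outside each set, hence also their difference.
  -- This is where a path segment acquires two bags as its border.
  small-∖ : ∀ {s A A′} → Small s A → Small s A′ → Small (s + s) (A ∖ A′)
  small-∖ {A = A} {A′} (B , B≤ , sep) (B′ , B′≤ , sep′) = B ∪ B′ , ≤-trans (∣∪∣≤ B B′) (+-mono-≤ B≤ B′≤) , both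
    where
    ∨-false : ∀ {a b} → a ∨ b ≡ false → a ≡ false × b ≡ false
    ∨-false {false} {false} _ = refl , refl
    out : ∀ {a b} → a ≡ false → a ∧ b ≡ false
    out refl = refl
    both : Separates G (B ∪ B′) (A ∖ A′)
    both v v∉ with ∨-false {lookup B v} (trans (sym (lookup-zipWith _∨_ v B B′)) v∉)
    ... | v∉B , v∉B′ with sep v v∉B | sep′ v v∉B′
    ...   | inj₂ o | _ = inj₂ λ e inc → out (o e inc)
    ...   | inj₁ i | inj₁ i′ = inj₂ λ e inc → cong₂ (λ a b → a ∧ not b) (i e inc) (i′ e inc)
    ...   | inj₁ i | inj₂ o′ = inj₁ λ e inc → cong₂ (λ a b → a ∧ not b) (i e inc) (o′ e inc)

  -- The parts of a join need only cover the whole; they may overlap.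
  data Tree (s : ℕ) : Edges → Set where
    nil  : ∀ {A} → (∀ e → A e ≡ false) → Tree s A
    one  : ∀ {A} → Small s A → ∀ e₀ → (∀ e → A e ≡ true → e ≡ e₀) → Tree s A
    join : ∀ {A A₁ A₂} → Small s A → Tree s A₁ → Tree s A₂ → Covers A A₁ A₂ → Tree s A

  size : ∀ {s A} → Tree s A → ℕ
  size (nil _) = 0
  size (one _ _ _) = 1
  size (join _ T₁ T₂ _) = size T₁ + size T₂

  tree-small : ∀ {s A} → Tree s A → Small s A
  tree-small (nil empty) = small-∅ empty
  tree-small (one small _ _) = small
  tree-small (join small _ _ _) = small

  leaves : ∀ {s A} → Tree s A → List (Fin m)
  leaves (nil _) = []
  leaves (one _ e₀ _) = e₀ ∷ []
  leaves (join _ T₁ T₂ _) = leaves T₁ ++ leaves T₂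

  length-leaves : ∀ {s A} (T : Tree s A) → length (leaves T) ≡ size T
  length-leaves (nil _) = refl
  length-leaves (one _ _ _) = refl
  length-leaves (join _ T₁ T₂ _) = trans (length-++ (leaves T₁)) (cong₂ _+_ (length-leaves T₁) (length-leaves T₂))

  ∈-leaves : ∀ {s A} (T : Tree s A) e → A e ≡ true → e ∈ leaves T
  ∈-leaves (nil empty) e Ae = contradiction (trans (sym Ae) (empty e)) λ ()
  ∈-leaves (one _ e₀ only) e Ae = here (only e Ae)
  ∈-leaves (join _ T₁ T₂ cover) e Ae with cover e Ae
  ... | inj₁ p = ∈-++⁺ˡ (∈-leaves T₁ e p)
  ... | inj₂ p = ∈-++⁺ʳ (leaves T₁) (∈-leaves T₂ e p)

  -- The path from the root A of a tree down to a subtree B, standing for the edges of A ∖ B.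
  data Context (s : ℕ) (B : Edges) : Edges → Set where
    hole : Context s B B
    down : ∀ {A H A′} → Small s A → Tree s H → Context s B A′ → Covers A H A′ → Context s B A

  csize : ∀ {s B A} → Context s B A → ℕ
  csize hole = 0
  csize (down _ T C _) = size T + csize C

  context-small : ∀ {s B A} → Small s B → Context s B A → Small s A
  context-small small hole = small
  context-small _ (down small _ _ _) = small

  cleaves : ∀ {s B A} → Context s B A → List (Fin m)
  cleaves hole = []
  cleaves (down _ T C _) = leaves T ++ cleaves C

  length-cleaves : ∀ {s B A} (C : Context s B A) → length (cleaves C) ≡ csize C
  length-cleaves hole = refl
  length-cleaves (down _ T C _) = trans (length-++ (leaves T)) (cong₂ _+_ (length-leaves T) (length-cleaves C))

  ∖-intro : ∀ A B {e} → A e ≡ true → B e ≡ false → (A ∖ B) e ≡ true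
  ∖-intro A B p q = cong₂ (λ a b → a ∧ not b) p q

  ∖-∖-self : ∀ A {e} → ¬ (A ∖ A) e ≡ true
  ∖-∖-self A {e} p with A e
  ∖-∖-self A {e} () | true
  ∖-∖-self A {e} () | false

  ∖-elim : ∀ A B {e} → (A ∖ B) e ≡ true → A e ≡ true × B e ≡ false
  ∖-elim A B {e} p with A e | B e
  ... | true | false = refl , refl

  ∈-cleaves : ∀ {s B A} (C : Context s B A) e → (A ∖ B) e ≡ true → e ∈ cleaves C
  ∈-cleaves {A = A} hole e p = contradiction p (∖-∖-self A)
  ∈-cleaves {B = B} {A} (down {A′ = A′} _ T C cover) e p with ∖-elim A B p
  ... | Ae , Be with cover e Ae
  ...   | inj₁ q = ∈-++⁺ˡ (∈-leaves T e q)
  ...   | inj₂ q = ∈-++⁺ʳ (leaves T) (∈-cleaves C e (∖-intro A′ B q Be))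

  AtMostOne : Edges → Set
  AtMostOne A = ∀ e f → A e ≡ true → A f ≡ true → e ≡ f

  short-cover : ∀ {A} (L : List (Fin m)) → length L ≤ 1 → (∀ e → A e ≡ true → e ∈ L) → AtMostOne A
  short-cover L le cover e f p q = go L le (cover e p) (cover f q)
    where
    go : ∀ L → length L ≤ 1 → e ∈ L → f ∈ L → e ≡ f
    go (g ∷ []) _ (here refl) (here refl) = refl
    go (_ ∷ _ ∷ _) (s≤s ()) _ _

  data Balanced (s : ℕ) : ℕ → Edges → Set where
    leaf : ∀ {d A} → AtMostOne A → Balanced s d A
    node : ∀ {d A A₁ A₂ A₃} → Small s A → Balanced s d A₁ → Balanced s d A₂ → Balanced s d A₃ →
           (∀ e → A e ≡ true → A₁ e ≡ true ⊎ A₂ e ≡ true ⊎ A₃ e ≡ true) → Balanced s (suc d) A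

  deepen : ∀ {s d A} → Balanced s d A → Balanced s (suc d) A
  deepen (leaf l) = leaf l
  deepen (node small T₁ T₂ T₃ cover) = node small (deepen T₁) (deepen T₂) (deepen T₃) cover

  -- `j` accumulates the leaves hung off the path during the descent, so that `ctx≤` bounds the
  -- whole path from the root and not just its rest.
  record TreeSplit (s p j : ℕ) (A : Edges) : Set where
    field
      {B B₁ B₂} : Edges
      ctx   : Context s B A
      small : Small s B
      T₁    : Tree s B₁
      T₂    : Tree s B₂
      cover : Covers B B₁ B₂
      ctx≤  : j + csize ctx ≤ p
      T₁≤   : size T₁ ≤ p
      T₂≤   : size T₂ ≤ p

  nil-cover : ∀ {A} → Covers A A ∅
  nil-cover e p = inj₁ p

  -- Descend into the child carrying more than half of the leaves, as long as there is one.
  split-tree : ∀ {s A} p → 1 ≤ p → (T : Tree s A) → ∀ j → j ≤ p → j + size T ≤ p + p → TreeSplit s p j A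
  split-tree p 1≤p (nil empty) j j≤ le = record
    { ctx = hole ; small = small-∅ empty ; T₁ = nil empty ; T₂ = nil {A = ∅} (λ _ → refl) ; cover = nil-cover
    ; ctx≤ = j+0≤ j≤ ; T₁≤ = z≤n ; T₂≤ = z≤n }
  split-tree p 1≤p (one small e₀ only) j j≤ le = record
    { ctx = hole ; small = small ; T₁ = one small e₀ only ; T₂ = nil {A = ∅} (λ _ → refl) ; cover = nil-cover
    ; ctx≤ = j+0≤ j≤ ; T₁≤ = 1≤p ; T₂≤ = z≤n }
  split-tree p 1≤p (join small T₁ T₂ cover) j j≤ le with size T₁ ≤? p | size T₂ ≤? p
  ... | yes p₁ | yes p₂ = record
    { ctx = hole ; small = small ; T₁ = T₁ ; T₂ = T₂ ; cover = cover ; ctx≤ = j+0≤ j≤ ; T₁≤ = p₁ ; T₂≤ = p₂ }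
  ... | no ¬p₁ | _ = record
    { ctx = down small T₂ (TreeSplit.ctx rest) (λ e p → Sum.swap (cover e p)) ; small = TreeSplit.small rest
    ; T₁ = TreeSplit.T₁ rest ; T₂ = TreeSplit.T₂ rest ; cover = TreeSplit.cover rest
    ; ctx≤ = ≤-trans (≤-reflexive (sym (+-assoc j (size T₂) _))) (TreeSplit.ctx≤ rest)
    ; T₁≤ = TreeSplit.T₁≤ rest ; T₂≤ = TreeSplit.T₂≤ rest }
    where
    rest = split-tree p 1≤p T₁ (j + size T₂) (half-left j (size T₁) (size T₂) (≰⇒> ¬p₁) le)
      (≤-trans (≤-reflexive (trans (+-assoc j (size T₂) (size T₁)) (cong (j +_) (+-comm (size T₂) (size T₁))))) le)
  ... | yes _ | no ¬p₂ = record
    { ctx = down small T₁ (TreeSplit.ctx rest) cover ; small = TreeSplit.small rest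
    ; T₁ = TreeSplit.T₁ rest ; T₂ = TreeSplit.T₂ rest ; cover = TreeSplit.cover rest
    ; ctx≤ = ≤-trans (≤-reflexive (sym (+-assoc j (size T₁) _))) (TreeSplit.ctx≤ rest)
    ; T₁≤ = TreeSplit.T₁≤ rest ; T₂≤ = TreeSplit.T₂≤ rest }
    where
    rest = split-tree p 1≤p T₂ (j + size T₁)
      (half-left j (size T₂) (size T₁) (≰⇒> ¬p₂) (≤-trans (≤-reflexive (cong (j +_) (+-comm (size T₂) (size T₁)))) le))
      (≤-trans (≤-reflexive (+-assoc j (size T₁) (size T₂))) le)

  record ContextSplit (s p j : ℕ) (B A : Edges) : Set where
    field
      {A₁ H A₂} : Edges
      upper  : Context s A₁ A
      tree   : Tree s H
      lower  : Context s B A₂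
      small₁ : Small s A₁
      cover  : Covers A₁ H A₂
      upper≤ : j + csize upper ≤ p
      tree≤  : size tree ≤ p + p
      lower≤ : csize lower ≤ p

  -- The cut is at the first node where the leaves hung off the path exceed `p`. The segments on
  -- both sides then have at most `p` leaves, but the subtree hung at that node may have almost all
  -- of them, hence its weaker bound `p + p`.
  split-context : ∀ {s B A} p (C : Context s B A) → ∀ j → j ≤ p → j + csize C ≤ p + p →
    j + csize C ≤ p ⊎ ContextSplit s p j B A
  split-context p hole j j≤ le = inj₁ (j+0≤ j≤)
  split-context p (down small T C cover) j j≤ le with j + size T ≤? p
  ... | no ¬le = inj₂ record
    { upper = hole ; tree = T ; lower = C ; small₁ = small ; cover = cover ; upper≤ = j+0≤ j≤
    ; tree≤ = ≤-trans (≤-trans (m≤m+n (size T) (csize C)) (m≤n+m _ j)) le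
    ; lower≤ = half-left 0 (j + size T) (csize C) (≰⇒> ¬le) (≤-trans (≤-reflexive (+-assoc j (size T) (csize C))) le) }
  ... | yes le′ with split-context p C (j + size T) le′ (≤-trans (≤-reflexive (+-assoc j (size T) (csize C))) le)
  ...   | inj₁ q = inj₁ (≤-trans (≤-reflexive (sym (+-assoc j (size T) (csize C)))) q)
  ...   | inj₂ rest = inj₂ record
    { upper = down small T (ContextSplit.upper rest) cover ; tree = ContextSplit.tree rest ; lower = ContextSplit.lower rest
    ; small₁ = ContextSplit.small₁ rest ; cover = ContextSplit.cover rest
    ; upper≤ = ≤-trans (≤-reflexive (sym (+-assoc j (size T) _))) (ContextSplit.upper≤ rest)
    ; tree≤ = ContextSplit.tree≤ rest ; lower≤ = ContextSplit.lower≤ rest }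

  BalanceTrees : ℕ → ℕ → Set
  BalanceTrees s d = ∀ {A} (T : Tree s A) → size T ≤ 2 ^ d → Balanced (s + s) (double d) A

  -- The extra level pays for the subtree hung at the cut, which may be as large as the context and
  -- is balanced as a tree of the same size class.
  BalanceContexts : ℕ → ℕ → Set
  BalanceContexts s d = ∀ {B A} → Small s B → (C : Context s B A) → csize C ≤ 2 ^ d →
    Balanced (s + s) (suc (double d)) (A ∖ B)

  -- The three parts are the path segment above the split node and the two subtrees below it, each
  -- with at most half of the leaf budget.
  balance-tree-suc : ∀ {s d} → BalanceTrees s d → BalanceContexts s d → BalanceTrees s (suc d)
  balance-tree-suc {s} {d} trees contexts {A} T le = node (small-mono (m≤m+n s s) (tree-small T))
      (contexts small ctx ctx≤) (deepen (trees T₁ T₁≤)) (deepen (trees T₂ T₂≤)) covers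
    where
    open TreeSplit (split-tree (2 ^ d) (m^n>0 2 d) T 0 z≤n (≤-trans le (≤-reflexive (2^suc d))))
    covers : ∀ e → A e ≡ true → (A ∖ B) e ≡ true ⊎ B₁ e ≡ true ⊎ B₂ e ≡ true
    covers e Ae with B e in Be
    ... | true = inj₂ (cover e Be)
    ... | false = inj₁ (cong (_∧ true) Ae)

  balance-context-suc : ∀ {s d} → BalanceTrees s (suc d) → BalanceContexts s d → BalanceContexts s (suc d)
  balance-context-suc {s} {d} trees contexts {B} {A} small C le
    with split-context (2 ^ d) C 0 z≤n (≤-trans le (≤-reflexive (2^suc d)))
  ... | inj₁ le′ = deepen (deepen (contexts small C le′))
  ... | inj₂ split = node (small-∖ (context-small small C) small)
      (deepen (contexts small₁ upper upper≤))
      (trees tree (≤-trans tree≤ (≤-reflexive (sym (2^suc d)))))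
      (deepen (contexts small lower lower≤)) covers
    where
    open ContextSplit split
    covers : ∀ e → (A ∖ B) e ≡ true → (A ∖ A₁) e ≡ true ⊎ H e ≡ true ⊎ (A₂ ∖ B) e ≡ true
    covers e p with ∖-elim A B p | A₁ e in A₁e
    ... | Ae , Be | false = inj₁ (cong (_∧ true) Ae)
    ... | Ae , Be | true with cover e A₁e
    ...   | inj₁ q = inj₂ (inj₁ q)
    ...   | inj₂ q = inj₂ (inj₂ (∖-intro A₂ B q Be))

  balance : ∀ s d → BalanceTrees s d × BalanceContexts s d
  balance s zero =
    (λ T le → leaf (short-cover (leaves T) (≤-trans (≤-reflexive (length-leaves T)) le) (∈-leaves T))) ,
    (λ _ C le → leaf (short-cover (cleaves C) (≤-trans (≤-reflexive (length-cleaves C)) le) (∈-cleaves C)))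
  balance s (suc d) = trees , balance-context-suc {d = d} trees (proj₂ (balance s d))
    where
    trees : BalanceTrees s (suc d)
    trees = balance-tree-suc {d = d} (proj₁ (balance s d)) (proj₂ (balance s d))

-- From a tree decomposition to a tree of edge sets

count-cong : ∀ {n} {f g : Fin n → Bool} → (∀ i → f i ≡ g i) → count f ≡ count g
count-cong eq = sumF-cong (cong ind ∘ eq)

count≤ : ∀ {n} (f : Fin n → Bool) → count f ≤ n
count≤ {zero} f = z≤n
count≤ {suc n} f with f zero
... | true = s≤s (count≤ (f ∘ suc))
... | false = m≤n⇒m≤1+n (count≤ (f ∘ suc))

module _ {n m : ℕ} (G : Graph n m) where

  small-cong : ∀ {s A A′} → (∀ e → A e ≡ A′ e) → Small G s A → Small G s A′
  small-cong eq (B , B≤ , sep) = B , B≤ , λ v v∉ →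
    Sum.map (λ i e inc → trans (sym (eq e)) (i e inc)) (λ o e inc → trans (sym (eq e)) (o e inc)) (sep v v∉)

  tree-cong : ∀ {s A A′} → (∀ e → A e ≡ A′ e) → (T : Tree G s A) → Σ (Tree G s A′) λ T′ → size G T′ ≡ size G T
  tree-cong eq (nil empty) = nil (λ e → trans (sym (eq e)) (empty e)) , refl
  tree-cong eq (one small e₀ only) = one (small-cong eq small) e₀ (λ e p → only e (trans (eq e) p)) , refl
  tree-cong eq (join small T₁ T₂ cover) = join (small-cong eq small) T₁ T₂ (λ e p → cover e (trans (eq e) p)) , refl

  SmallTree : ℕ → Edges G → Set
  SmallTree s A = Σ (Tree G s A) λ T → size G T ≤ count A

  Within : Subset n → Edges G → Set
  Within B A = ∀ e v → A e ≡ true → incident G e v ≡ true → lookup B v ≡ true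

  within⇒small : ∀ {s A} B → ∣ B ∣ ≤ s → Within B A → Small G s A
  within⇒small {A = A} B B≤ within = B , B≤ , λ v v∉ → inj₂ λ e inc → outside v v∉ e inc
    where
    outside : ∀ v → lookup B v ≡ false → ∀ e → incident G e v ≡ true → A e ≡ false
    outside v v∉ e inc with A e in Ae
    ... | false = refl
    ... | true = contradiction (trans (sym (within e v Ae inc)) v∉) λ ()

  -- All these edges live in one bag, which is a border for every subset of them, so they can be
  -- split off one at a time.
  bag-tree : ∀ {s} B → ∣ B ∣ ≤ s → ∀ L A → (∀ e → A e ≡ true → e ∈ L) → Within B A →
    Σ (Tree G s A) λ T → size G T ≤ sumOver (ind ∘ A) L
  bag-tree B B≤ [] A listed within = nil none , z≤n
    where
    none : ∀ e → A e ≡ false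
    none e with A e in Ae
    ... | false = refl
    ... | true = contradiction (listed e Ae) λ ()
  bag-tree {s} B B≤ (e₀ ∷ L) A listed within with A e₀ in Ae₀
  ... | false = bag-tree B B≤ L A listed′ within
    where
    listed′ : ∀ e → A e ≡ true → e ∈ L
    listed′ e Ae with listed e Ae
    ... | there e∈ = e∈
    ... | here refl = contradiction (trans (sym Ae) Ae₀) λ ()
  ... | true = join (within⇒small B B≤ within) (proj₁ rest) (one (within⇒small B B≤ within₀) e₀ only) covers ,
      ≤-trans (≤-reflexive (+-comm _ 1)) (s≤s (≤-trans (proj₂ rest) (sumOver-mono fewer L)))
    where
    single : Edges G
    single e = does (e ≟ e₀)
    A′ : Edges G
    A′ e = A e ∧ not (single e)
    only : ∀ e → single e ≡ true → e ≡ e₀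
    only e p with e ≟ e₀
    ... | yes eq = eq
    only e () | no _
    within₀ : Within B single
    within₀ e v p inc with only e p
    ... | refl = within e₀ v Ae₀ inc
    listed′ : ∀ e → A′ e ≡ true → e ∈ L
    listed′ e p with ∖-elim G A single p
    ... | Ae , ne with listed e Ae
    ...   | there e∈ = e∈
    ...   | here refl = contradiction (trans (sym ne) (dec-true (e ≟ e) refl)) λ ()
    fewer : ∀ e → ind (A′ e) ≤ ind (A e)
    fewer e with A e | single e
    ... | true | true = z≤n
    ... | true | false = ≤-refl
    ... | false | _ = ≤-refl
    rest = bag-tree {s} B B≤ L A′ listed′ (λ e v p → within e v (proj₁ (∖-elim G A single p)))
    covers : Covers G A A′ single
    covers e Ae with single e
    ... | true = inj₂ refl
    ... | false = inj₁ (cong (_∧ true) Ae)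

  -- The nodes are contracted into their parents from the last to the first; β sends an edge to the
  -- node currently holding it.
  module Contract {t : ℕ} (D : TreeDecomposition G t) where
    open TreeDecomposition D

    Node : Set
    Node = Fin (suc k)

    -- Adjacency in the subtree on the nodes of index at most j, inside the bags containing v.
    Step : ℕ → Fin n → Node → Node → Set
    Step j v a b = (∃[ i ] (toℕ {k} i < j × ((a ≡ suc i × b ≡ parent i) ⊎ (b ≡ suc i × a ≡ parent i))))
                 × lookup (bag a) v ≡ true × lookup (bag b) v ≡ true

    at : (Fin m → Node) → Node → Edges G
    at β x e = does (β e ≟ x)

    at⁻ : ∀ β {x e} → at β x e ≡ true → β e ≡ x
    at⁻ β {x} {e} p with β e ≟ x
    ... | yes eq = eq
    at⁻ β {x} {e} () | no _

    at-false : ∀ β {x e} → ¬ β e ≡ x → at β x e ≡ false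
    at-false β {x} {e} ne = dec-false (β e ≟ x) ne

    -- Bags never grow, so after contractions an edge may sit at a node whose bag misses an endpoint
    -- `v`. The path is then empty, and this says that all edges at `v` sit at that node.
    Linked : ℕ → (Fin m → Node) → Set
    Linked j β = ∀ v e f → incident G e v ≡ true → incident G f v ≡ true → Star (Step j v) (β e) (β f)

    record State (j : ℕ) : Set where
      field
        β      : Fin m → Node
        β≤     : ∀ e → toℕ (β e) ≤ j
        linked : Linked j β
        trees  : ∀ x → SmallTree (suc t) (at β x)

    -- If `v` is outside the bag of `x` but has an edge there, the link to any other edge at `v`
    -- cannot take a first step. All edges at `v` are then at `x`.
    linked⇒small : ∀ {j} β → Linked j β → ∀ x → Small G (suc t) (at β x)
    linked⇒small {j} β linked x = bag x , width x , sep
      where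
      sep : Separates G (bag x) (at β x)
      sep v v∉ with any? (λ e → (incident G e v ≟ᵇ true) ×-dec (β e ≟ x))
      ... | no none = inj₂ λ e inc → at-false β λ eq → none (e , inc , eq)
      ... | yes (e , inc , refl) = inj₁ λ f inc′ → dec-true (β f ≟ β e) (sym (stay (linked v e f inc inc′)))
        where
        stay : ∀ {y} → Star (Step j v) (β e) y → β e ≡ y
        stay ε = refl
        stay ((_ , v∈ , _) ◅ _) = contradiction (trans (sym v∈) v∉) λ ()

    initial : State k
    initial = record { β = β ; β≤ = λ e → s≤s⁻¹ (toℕ<n (β e)) ; linked = linked ; trees = trees }
      where
      β : Fin m → Node
      β e = proj₁ (ecover e)
      in-bag : ∀ e v → incident G e v ≡ true → lookup (bag (β e)) v ≡ true
      in-bag e v inc with incident⇒joins G {e} inc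
      ... | w , inj₁ eq = subst (λ p → lookup (bag (β e)) (proj₁ p) ≡ true) eq ([]=⇒lookup (proj₁ (proj₂ (ecover e))))
      ... | w , inj₂ eq = subst (λ p → lookup (bag (β e)) (proj₂ p) ≡ true) eq ([]=⇒lookup (proj₂ (proj₂ (ecover e))))
      linked : Linked k β
      linked v e f inc inc′ = gmap id convert
        (connected v (β e) (β f) (lookup⇒[]= v (bag (β e)) (in-bag e v inc)) (lookup⇒[]= v (bag (β f)) (in-bag f v inc′)))
        where
        convert : ∀ {a b} → TreeAdj parent a b × bag a Vec.[ v ]= true × bag b Vec.[ v ]= true → Step k v a b
        convert ((i , adj) , v∈a , v∈b) = (i , toℕ<n i , adj) , []=⇒lookup v∈a , []=⇒lookup v∈b
      trees : ∀ x → SmallTree (suc t) (at β x)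
      trees x with bag-tree (bag x) (width x) (List.allFin m) (at β x) (λ e _ → ∈-allFin e)
                     (λ e v p inc → subst (λ y → lookup (bag y) v ≡ true) (at⁻ β p) (in-bag e v inc))
      ... | T , le = T , ≤-trans le (≤-reflexive (sumOver-tabulate (ind ∘ at β x) id))

    contract : ∀ (i₀ : Fin k) → State (suc (toℕ i₀)) → State (toℕ i₀)
    contract i₀ state = record { β = β′ ; β≤ = β′≤ ; linked = linked′ ; trees = trees′ }
      where
      open State state
      j = toℕ i₀
      p last : Node
      p = parent i₀
      last = suc i₀
      c : Node → Node
      c y = if does (y ≟ last) then p else y
      c-last : c last ≡ p
      c-last rewrite dec-true (last ≟ last) refl = refl
      c-other : ∀ {y} → ¬ y ≡ last → c y ≡ y
      c-other {y} ne rewrite dec-false (y ≟ last) ne = refl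
      parent≢ : ∀ i → toℕ i ≤ j → ¬ parent i ≡ last
      parent≢ i le eq = <-irrefl (cong toℕ eq) (s≤s (≤-trans (parent< i) le))
      β′ : Fin m → Node
      β′ e = c (β e)
      β′≤ : ∀ e → toℕ (β′ e) ≤ j
      β′≤ e with β e ≟ last
      ... | yes _ = parent< i₀
      ... | no ne with m≤n⇒m<n∨m≡n (β≤ e)
      ...   | inj₁ lt = s≤s⁻¹ lt
      ...   | inj₂ eq = contradiction (toℕ-injective eq) ne
      -- The tree edge `i₀` collapses to a point. The earlier tree edges avoid the contracted node,
      -- because parents precede their children.
      step′ : ∀ {v a b} → Step (suc j) v a b → Star (Step j v) (c a) (c b)
      step′ ((i , i<sj , adj) , v∈a , v∈b) with m≤n⇒m<n∨m≡n (s≤s⁻¹ i<sj)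
      ... | inj₂ eq with toℕ-injective eq | adj
      ...   | refl | inj₁ (refl , refl) rewrite c-last | c-other (parent≢ i₀ ≤-refl) = ε
      ...   | refl | inj₂ (refl , refl) rewrite c-last | c-other (parent≢ i₀ ≤-refl) = ε
      step′ {v} {a} {b} ((i , i<sj , adj) , v∈a , v∈b) | inj₁ i<j =
        subst₂ (Star (Step j v)) (sym (c-other (proj₁ (off adj)))) (sym (c-other (proj₂ (off adj))))
          (((i , i<j , adj) , v∈a , v∈b) ◅ ε)
        where
        suc≢ : ¬ suc i ≡ last
        suc≢ eq = <-irrefl (cong toℕ eq) (s≤s i<j)
        off : (a ≡ suc i × b ≡ parent i) ⊎ (b ≡ suc i × a ≡ parent i) → ¬ a ≡ last × ¬ b ≡ last
        off (inj₁ (refl , refl)) = suc≢ , parent≢ i (<⇒≤ i<j)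
        off (inj₂ (refl , refl)) = parent≢ i (<⇒≤ i<j) , suc≢
      linked′ : Linked j β′
      linked′ v e f inc inc′ = kleisliStar c step′ (linked v e f inc inc′)
      trees′ : ∀ x → SmallTree (suc t) (at β′ x)
      trees′ x with x ≟ p
      -- The parent takes over the edges of the contracted node, and its own bag is still a border
      -- by the links just transported.
      ... | yes refl = join (linked⇒small β′ linked′ p) (proj₁ (trees p)) (proj₁ (trees last)) covers ,
              ≤-trans (+-mono-≤ (proj₂ (trees p)) (proj₂ (trees last)))
                (≤-trans (≤-reflexive (sym (sumF-+ (λ e → ind (at β p e)) (λ e → ind (at β last e))))) (sumF-mono merged))
        where
        covers : Covers G (at β′ p) (at β p) (at β last)
        covers e q with β e ≟ last
        ... | yes _ = inj₂ refl
        ... | no _ = inj₁ q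
        merged : ∀ e → ind (at β p e) + ind (at β last e) ≤ ind (at β′ p e)
        merged e with β e ≟ last
        ... | yes eq rewrite dec-false (β e ≟ p) (λ eq′ → parent≢ i₀ ≤-refl (trans (sym eq′) eq)) | dec-true (p ≟ p) refl = ≤-refl
        ... | no _ = ≤-reflexive (+-identityʳ _)
      ... | no x≢p with x ≟ last
      ...   | yes refl = nil (λ e → at-false β′ λ eq → <-irrefl (cong toℕ eq) (s≤s (β′≤ e))) , z≤n
      ...   | no x≢last = let T , eq = tree-cong unchanged (proj₁ (trees x)) in
              T , ≤-trans (≤-reflexive eq) (≤-trans (proj₂ (trees x)) (≤-reflexive (count-cong unchanged)))
        where
        unchanged : ∀ e → at β x e ≡ at β′ x e
        unchanged e with β e ≟ last
        ... | yes eq rewrite dec-false (p ≟ x) (x≢p ∘ sym) = dec-false (β e ≟ x) (λ eq′ → x≢last (trans (sym eq′) eq))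
        ... | no _ = refl

    contract-all : ∀ j → j ≤ k → State j → State 0
    contract-all zero _ state = state
    contract-all (suc j) j<k state = contract-all j (<⇒≤ j<k)
      (subst State (toℕ-fromℕ< j<k) (contract (fromℕ< j<k) (subst (State ∘ suc) (sym (toℕ-fromℕ< j<k)) state)))

    edge-tree : Σ (Tree G (suc t) (λ _ → true)) λ T → size G T ≤ m
    edge-tree = let T , eq = tree-cong everything (proj₁ (State.trees final zero)) in
      T , ≤-trans (≤-reflexive eq) (≤-trans (proj₂ (State.trees final zero)) (count≤ _))
      where
      final : State 0
      final = contract-all k ≤-refl initial
      everything : ∀ e → at (State.β final) zero e ≡ true
      everything e = dec-true (State.β final e ≟ zero) (toℕ-injective (n≤0⇒n≡0 (State.β≤ final e)))

-- Isolation along a balanced decomposition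

subset-ext : ∀ {m} {X Y : Subset m} → (∀ e → lookup X e ≡ lookup Y e) → X ≡ Y
subset-ext {X = X} {Y} eq = trans (sym (tabulate∘lookup X)) (trans (tabulate-cong eq) (tabulate∘lookup Y))

_≟ˢ_ : ∀ {m} (X Y : Subset m) → Dec (X ≡ Y)
_≟ˢ_ = ≡-dec _≟ᵇ_

weight-scale : ∀ {m} b (ω h : Fin m → ℕ) X → weight (λ e → b * ω e + h e) X ≡ b * weight ω X + weight h X
weight-scale b ω h X = trans (sumF-cong pointwise) (trans (sumF-+ (λ e → b * part ω e) (part h)) (cong (_+ weight h X) (sumF-* b (part ω))))
  where
  part : (Fin _ → ℕ) → Fin _ → ℕ
  part ω e = if lookup X e then ω e else 0
  pointwise : ∀ e → (if lookup X e then b * ω e + h e else 0) ≡ b * part ω e + part h e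
  pointwise e with lookup X e
  ... | true = refl
  ... | false = sym (trans (+-identityʳ (b * 0)) (*-zeroʳ b))

weight≤ : ∀ {m r} (h : Fin m → ℕ) → (∀ e → h e ≤ r) → ∀ X → weight h X ≤ m * r
weight≤ {m} {r} h h≤ X = ≤-trans (sumF-mono pointwise) (≤-reflexive (sumF-const m r))
  where
  pointwise : ∀ e → (if lookup X e then h e else 0) ≤ r
  pointwise e with lookup X e
  ... | true = h≤ e
  ... | false = z≤n

restrict : ∀ {m} → (Fin m → Bool) → Subset m → Subset m
restrict {m} A Z = mix A Z (Vec.replicate m false)

-- Replacing the part of `Z` in `A` by that of `X` changes the weight by the difference of these
-- parts. The additive form avoids subtraction.
weight-exchange : ∀ {m} (ω : Fin m → ℕ) A X Z →
  weight ω (mix A X Z) + weight ω (restrict A Z) ≡ weight ω (restrict A X) + weight ω Z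
weight-exchange {m} ω A X Z = trans (sym (sumF-+ (part (mix A X Z)) (part (restrict A Z))))
  (trans (sumF-cong pointwise) (sumF-+ (part (restrict A X)) (part Z)))
  where
  part : Subset m → Fin m → ℕ
  part X e = if lookup X e then ω e else 0
  pointwise : ∀ e → part (mix A X Z) e + part (restrict A Z) e ≡ part (restrict A X) e + part Z e
  pointwise e rewrite lookup-mix A X Z e | lookup-mix A Z (Vec.replicate m false) e | lookup-mix A X (Vec.replicate m false) e
    | lookup-replicate e false with A e
  ... | true = refl
  ... | false = +-identityʳ _

lookup-restrict : ∀ {m} (A : Fin m → Bool) Z e → lookup (restrict A Z) e ≡ (A e ∧ lookup Z e)
lookup-restrict {m} A Z e rewrite lookup-mix A Z (Vec.replicate m false) e | lookup-replicate e false with A e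
... | true = refl
... | false = refl

restrict-idem : ∀ {m} (A : Fin m → Bool) Z → restrict A (restrict A Z) ≡ restrict A Z
restrict-idem A Z = subset-ext λ e → trans (lookup-restrict A (restrict A Z) e)
  (trans (cong (A e ∧_) (lookup-restrict A Z e)) (trans (idem (A e) (lookup Z e)) (sym (lookup-restrict A Z e))))
  where
  idem : ∀ a b → a ∧ (a ∧ b) ≡ a ∧ b
  idem true b = refl
  idem false b = refl

mix-restrict : ∀ {m} (A : Fin m → Bool) Z → mix A (restrict A Z) Z ≡ Z
mix-restrict A Z = subset-ext pointwise
  where
  pointwise : ∀ e → lookup (mix A (restrict A Z) Z) e ≡ lookup Z e
  pointwise e rewrite lookup-mix A (restrict A Z) Z e | lookup-restrict A Z e with A e
  ... | true = refl
  ... | false = refl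

Pairs : ℕ → Set
Pairs m = List (Subset m × Subset m)

Distinguishes : ∀ {m} → (Fin m → ℕ) → Pairs m → Set
Distinguishes h P = ∀ X Y → (X , Y) ∈ P → ¬ X ≡ Y → ¬ weight h X ≡ weight h Y

-- With b larger than every weight of h, the weights b ω + h compare lexicographically by (ω , h).
lex-≤ : ∀ b {w w′ h h′} → h < b → h′ < b → b * w + h ≤ b * w′ + h′ → w ≤ w′
lex-≤ b {w} {w′} {h} {h′} h< h′< le with w ≤? w′
... | yes p = p
... | no ¬p = contradiction le (<⇒≱ (begin-strict
    b * w′ + h′ <⟨ +-monoʳ-< (b * w′) h′< ⟩
    b * w′ + b ≡⟨ trans (+-comm (b * w′) b) (sym (*-suc b w′)) ⟩
    b * suc w′ ≤⟨ *-monoʳ-≤ b (≰⇒> ¬p) ⟩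
    b * w ≤⟨ m≤m+n (b * w) h ⟩
    b * w + h ∎))
  where open ≤-Reasoning

lex-≡ : ∀ b {w w′ h h′} → h < b → h′ < b → b * w + h ≡ b * w′ + h′ → h ≡ h′
lex-≡ b {w} {w′} h< h′< eq with ≤-antisym (lex-≤ b h< h′< (≤-reflexive eq)) (lex-≤ b h′< h< (≤-reflexive (sym eq)))
... | refl = +-cancelˡ-≡ (b * w) _ _ eq

-- `K` bounds the candidates kept for a piece. Combining three lists gives up to K³ sets, and `K⁶`
-- counts the pairs of those.
K K⁶ : ℕ → ℕ
K s = 6 ^ s
K⁶ s = (K s * (K s * K s)) * (K s * (K s * K s))

module _ {n m : ℕ} (G : Graph (suc n) m) where

  Minimal : (Fin m → ℕ) → Subset m → Set
  Minimal ω Z = hamiltonian G Z ≡ true × (∀ Y → hamiltonian G Y ≡ true → weight ω Z ≤ weight ω Y)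

  -- Appended digits only break ties, so the minimisers can only become fewer and the candidate
  -- lists of lower levels stay valid.
  Refines : (Fin m → ℕ) → (Fin m → ℕ) → Set
  Refines ω′ ω = ∀ Z → Minimal ω′ Z → Minimal ω Z

  module _ {ω h : Fin m → ℕ} {b : ℕ} (h< : ∀ X → weight h X < b) where

    scaled : Fin m → ℕ
    scaled e = b * ω e + h e

    scaled-refines : Refines scaled ω
    scaled-refines Z (ham , min) = ham , λ Y hamY → lex-≤ b (h< Z) (h< Y)
      (subst₂ _≤_ (weight-scale b ω h Z) (weight-scale b ω h Y) (min Y hamY))

    scaled-distinguishes : ∀ {P} → Distinguishes h P → Distinguishes scaled P
    scaled-distinguishes dist X Y p X≢Y eq = dist X Y p X≢Y (lex-≡ b (h< X) (h< Y)
      (trans (sym (weight-scale b ω h X)) (trans eq (weight-scale b ω h Y))))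

  module _ (s : ℕ) (1≤s : 1 ≤ s) where

    -- The list has to capture the traces on `A` of the cycles that are minimal in the whole graph.
    -- This is what allows exchange arguments against everything outside `A`.
    Solved : (Fin m → ℕ) → Edges G → Set
    Solved ω A = ∃[ C ] (length C ≤ K s × (∀ Z → Minimal ω Z → restrict A Z ∈ C))

    solved-leaf : ∀ {ω A} → AtMostOne G A → Solved ω A
    -- A piece with at most one edge has at most two traces, and `1 ≤ s` makes room for both in
    -- `K s`.
    solved-leaf {A = A} atMost = full ∷ empty ∷ [] , ≤-trans (s≤s (s≤s z≤n)) (^-monoʳ-≤ 6 1≤s) , λ Z _ → classify Z
      where
      full empty : Subset m
      full = restrict A (Vec.replicate m true)
      empty = Vec.replicate m false
      lookup-full : ∀ e → lookup full e ≡ A e ∧ true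
      lookup-full e = trans (lookup-restrict A (Vec.replicate m true) e) (cong (A e ∧_) (lookup-replicate e true))
      classify : ∀ Z → restrict A Z ∈ (full ∷ empty ∷ [])
      classify Z with any? (λ e → (A e ≟ᵇ true) ×-dec (lookup Z e ≟ᵇ true))
      ... | yes (e₀ , Ae₀ , Ze₀) = here (subset-ext λ e → trans (lookup-restrict A Z e) (trans (pointwise e) (sym (lookup-full e))))
        where
        pointwise : ∀ e → A e ∧ lookup Z e ≡ A e ∧ true
        pointwise e with A e in Ae
        ... | false = refl
        ... | true with atMost e e₀ Ae Ae₀
        ...   | refl = Ze₀
      ... | no none = there (here (subset-ext λ e → trans (lookup-restrict A Z e) (trans (pointwise e) (sym (lookup-replicate e false)))))
        where
        pointwise : ∀ e → A e ∧ lookup Z e ≡ false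
        pointwise e with A e in Ae | lookup Z e in Ze
        ... | false | _ = refl
        ... | true | false = refl
        ... | true | true = contradiction (e , Ae , Ze) none

    -- The parts may overlap and reach beyond `A`, so they are combined by a union cut back to `A`.
    glue : Edges G → Subset m → Subset m × Subset m → Subset m
    glue A X (Y , W) = restrict A (X ∪ (Y ∪ W))

    glue-restrict : ∀ {A A₁ A₂ A₃} → (∀ e → A e ≡ true → A₁ e ≡ true ⊎ A₂ e ≡ true ⊎ A₃ e ≡ true) → ∀ Z →
      glue A (restrict A₁ Z) (restrict A₂ Z , restrict A₃ Z) ≡ restrict A Z
    glue-restrict {A} {A₁} {A₂} {A₃} cover Z = subset-ext λ e →
      trans (lookup-restrict A (restrict A₁ Z ∪ (restrict A₂ Z ∪ restrict A₃ Z)) e) (trans (cong (A e ∧_) (lookup-union e)) (trans (pointwise e) (sym (lookup-restrict A Z e))))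
      where
      lookup-union : ∀ e → lookup (restrict A₁ Z ∪ (restrict A₂ Z ∪ restrict A₃ Z)) e
        ≡ (A₁ e ∧ lookup Z e) ∨ ((A₂ e ∧ lookup Z e) ∨ (A₃ e ∧ lookup Z e))
      lookup-union e = trans (lookup-zipWith _∨_ e (restrict A₁ Z) (restrict A₂ Z ∪ restrict A₃ Z))
        (cong₂ _∨_ (lookup-restrict A₁ Z e) (trans (lookup-zipWith _∨_ e (restrict A₂ Z) (restrict A₃ Z))
          (cong₂ _∨_ (lookup-restrict A₂ Z e) (lookup-restrict A₃ Z e))))
      pointwise : ∀ e → A e ∧ ((A₁ e ∧ lookup Z e) ∨ ((A₂ e ∧ lookup Z e) ∨ (A₃ e ∧ lookup Z e))) ≡ A e ∧ lookup Z e
      pointwise e with A e in Ae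
      ... | false = refl
      ... | true = go (A₁ e) (A₂ e) (A₃ e) (lookup Z e) (cover e Ae)
        where
        go : ∀ a b c z → a ≡ true ⊎ b ≡ true ⊎ c ≡ true → (a ∧ z) ∨ ((b ∧ z) ∨ (c ∧ z)) ≡ z
        go true b c true _ = refl
        go false true c true _ = refl
        go false false true true _ = refl
        go a b c false _ = trans (cong₂ _∨_ (∧-zeroʳ a) (cong₂ _∨_ (∧-zeroʳ b) (∧-zeroʳ c))) refl
        go false false false true (inj₁ ())
        go false false false true (inj₂ (inj₁ ()))
        go false false false true (inj₂ (inj₂ ()))

    -- The pairs `P` are chosen before `ω′`: they depend only on the lists of the parts, and so the
    -- new hashes that confuse one of them can be counted.
    solved-node : ∀ {ω A A₁ A₂ A₃} → Small G s A → Solved ω A₁ → Solved ω A₂ → Solved ω A₃ →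
      (∀ e → A e ≡ true → A₁ e ≡ true ⊎ A₂ e ≡ true ⊎ A₃ e ≡ true) →
      ∃[ P ] (length P ≤ K⁶ s × (∀ ω′ → Refines ω′ ω → Distinguishes ω′ P → Solved ω′ A))
    solved-node {ω} {A} {A₁} {A₂} {A₃} (B , B≤ , sep) (C₁ , C₁≤ , in₁) (C₂ , C₂≤ , in₂) (C₃ , C₃≤ , in₃) cover =
      cartesianProduct C C , pairs≤ , solve
      where
      C : List (Subset m)
      C = cartesianProductWith (glue A) C₁ (cartesianProduct C₂ C₃)
      C≤ : length C ≤ K s * (K s * K s)
      C≤ = ≤-trans (≤-reflexive (length-cartesianProductWith (glue A) C₁ (cartesianProduct C₂ C₃)))
        (*-mono-≤ C₁≤ (≤-trans (≤-reflexive (length-cartesianProductWith _,_ C₂ C₃)) (*-mono-≤ C₂≤ C₃≤)))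
      pairs≤ : length (cartesianProduct C C) ≤ K⁶ s
      pairs≤ = ≤-trans (≤-reflexive (length-cartesianProductWith _,_ C C)) (*-mono-≤ C≤ C≤)
      ∈C : ∀ Z → Minimal ω Z → restrict A Z ∈ C
      ∈C Z min = subst (_∈ C) (glue-restrict cover Z)
        (∈-cartesianProductWith⁺ (glue A) (in₁ Z min) (∈-cartesianProduct⁺ (in₂ Z min) (in₃ Z min)))
      supported : ∀ {X} → X ∈ C → restrict A X ≡ X
      supported X∈ with ∈-cartesianProductWith⁻ (glue A) C₁ (cartesianProduct C₂ C₃) X∈
      ... | Y , (W , W′) , _ , _ , refl = restrict-idem A (Y ∪ (W ∪ W′))
      rank = rank-hamiltonian G B A sep
      solve : ∀ ω′ → Refines ω′ ω → Distinguishes ω′ (cartesianProduct C C) → Solved ω′ A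
      solve ω′ refines dist with representatives (weight ω′) (proj₂ (proj₂ rank)) C
      ... | R , R≤ , keep = R , ≤-trans R≤ (≤-trans (proj₁ (proj₂ rank)) (^-monoʳ-≤ 6 B≤)) ,
        -- The column is indexed by the whole minimiser `Z`; `mix A X Z` reads only its part outside
        -- `A`.
        λ Z min → keep {y = Z} (∈C Z (refines Z min)) (trans (cong (hamiltonian G) (mix-restrict A Z)) (proj₁ min) , λ {X} → strict Z min X)
        where
        -- If `X` also completes `Z` outside `A`, then `mix A X Z` competes with `Z`, so the trace
        -- of `Z` is no heavier than `X`. Distinct weights make this strict.
        strict : ∀ Z → Minimal ω′ Z → ∀ X → X ∈ C → hamiltonian G (mix A X Z) ≡ true →
          X ≡ restrict A Z ⊎ weight ω′ (restrict A Z) < weight ω′ X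
        strict Z min X X∈ ham with X ≟ˢ restrict A Z
        ... | yes eq = inj₁ eq
        ... | no ne = inj₂ (≤∧≢⇒< lighter (dist (restrict A Z) X (∈-cartesianProduct⁺ (∈C Z (refines Z min)) X∈) (ne ∘ sym)))
          where
          lighter : weight ω′ (restrict A Z) ≤ weight ω′ X
          lighter = +-cancelˡ-≤ (weight ω′ (mix A X Z)) _ _ (begin
            weight ω′ (mix A X Z) + weight ω′ (restrict A Z) ≡⟨ weight-exchange ω′ A X Z ⟩
            weight ω′ (restrict A X) + weight ω′ Z ≡⟨ cong (λ Y → weight ω′ Y + weight ω′ Z) (supported X∈) ⟩
            weight ω′ X + weight ω′ Z ≤⟨ +-monoʳ-≤ (weight ω′ X) (proj₂ min (mix A X Z) ham) ⟩
            weight ω′ X + weight ω′ (mix A X Z) ≡⟨ +-comm (weight ω′ X) _ ⟩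
            weight ω′ (mix A X Z) + weight ω′ X ∎)
            where open ≤-Reasoning

    Piece : ℕ → Set
    Piece d = Σ (Edges G) (Balanced G s d)

    SolvedAll : ∀ {d} → (Fin m → ℕ) → List (Piece d) → Set
    SolvedAll ω = All (Solved ω ∘ proj₁)

    children : ∀ {d} → List (Piece (suc d)) → List (Piece d)
    children [] = []
    children ((_ , leaf _) ∷ F) = children F
    children ((_ , node _ T₁ T₂ T₃ _) ∷ F) = (_ , T₁) ∷ (_ , T₂) ∷ (_ , T₃) ∷ children F

    length-children : ∀ {d} (F : List (Piece (suc d))) → length (children F) ≤ 3 * length F
    length-children [] = z≤n
    length-children ((_ , leaf _) ∷ F) = ≤-trans (length-children F) (*-monoʳ-≤ 3 (n≤1+n (length F)))
    length-children ((_ , node _ _ _ _ _) ∷ F) = ≤-trans (+-monoʳ-≤ 3 (length-children F)) (≤-reflexive (sym (*-suc 3 (length F))))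

    -- A single hash serves all pieces of a level, so their pairs are collected in one list.
    solved-forest : ∀ {d ω} (F : List (Piece (suc d))) → SolvedAll ω (children F) →
      ∃[ P ] (length P ≤ length F * K⁶ s × (∀ ω′ → Refines ω′ ω → Distinguishes ω′ P → SolvedAll ω′ F))
    solved-forest [] _ = [] , z≤n , λ _ _ _ → []
    solved-forest ((A , leaf atMost) ∷ F) solved with solved-forest F solved
    ... | P , P≤ , solve = P , ≤-trans P≤ (m≤n+m _ (K⁶ s)) , λ ω′ ref dist → solved-leaf atMost ∷ solve ω′ ref dist
    solved-forest ((A , node small _ _ _ cover) ∷ F) (s₁ ∷ s₂ ∷ s₃ ∷ solved)
      with solved-node small s₁ s₂ s₃ cover | solved-forest F solved
    ... | P , P≤ , solve | Q , Q≤ , solves = P ++ Q , ≤-trans (≤-reflexive (length-++ P)) (+-mono-≤ P≤ Q≤) ,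
      λ ω′ ref dist → solve ω′ ref (λ X Y p → dist X Y (∈-++⁺ˡ p)) ∷ solves ω′ ref (λ X Y p → dist X Y (∈-++⁺ʳ P p))

    solved-leaves : ∀ {ω} (F : List (Piece 0)) → SolvedAll ω F
    solved-leaves [] = []
    solved-leaves ((_ , leaf atMost) ∷ F) = solved-leaf atMost ∷ solved-leaves F

-- Counting the seeds spoilt by one more hash

length-filter-tabulate : ∀ {n} {A : Set} {P : A → Set} (P? : ∀ x → Dec (P x)) (f : Fin n → A) →
  length (filter P? (List.tabulate f)) ≡ sumF (λ i → ind (does (P? (f i))))
length-filter-tabulate {zero} P? f = refl
length-filter-tabulate {suc n} P? f with does (P? (f zero))
... | true = cong suc (length-filter-tabulate P? (f ∘ suc))
... | false = length-filter-tabulate P? (f ∘ suc)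

length-concatMap≤ : {A B : Set} {k : ℕ} (f : A → List B) → (∀ x → length (f x) ≤ k) → ∀ xs → length (concatMap f xs) ≤ length xs * k
length-concatMap≤ f f≤ [] = z≤n
length-concatMap≤ f f≤ (x ∷ xs) = ≤-trans (≤-reflexive (length-++ (f x))) (+-mono-≤ (f≤ x) (length-concatMap≤ f f≤ xs))

module _ {m L κ : ℕ} (H : Fin L → Fin m → ℕ) (few : ∀ X Y → ¬ X ≡ Y → collisions H X Y ≤ κ) where

  clash : Subset m × Subset m → List (Fin L)
  clash (X , Y) with X ≟ˢ Y
  ... | yes _ = []
  ... | no _ = filter (λ i → weight (H i) X ≟ℕ weight (H i) Y) (List.allFin L)

  length-clash : ∀ p → length (clash p) ≤ κ
  length-clash (X , Y) with X ≟ˢ Y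
  ... | yes _ = z≤n
  ... | no ne = ≤-trans (≤-reflexive (length-filter-tabulate (λ i → weight (H i) X ≟ℕ weight (H i) Y) id)) (few X Y ne)

  ∈-clash : ∀ {X Y i} → ¬ X ≡ Y → weight (H i) X ≡ weight (H i) Y → i ∈ clash (X , Y)
  ∈-clash {X} {Y} {i} ne eq with X ≟ˢ Y
  ... | yes p = contradiction p ne
  ... | no _ = ∈-filter⁺ (λ i → weight (H i) X ≟ℕ weight (H i) Y) (∈-allFin i) eq

  distinguishes : ∀ {P i} → i ∉ concatMap clash P → Distinguishes (H i) P
  distinguishes {P} i∉ X Y p ne eq = i∉ (∈-concatMap⁺ clash {xs = P} (lose p (∈-clash {X} {Y} ne eq)))

  module _ {ℓ q : ℕ} (bad : List (Fin ℓ)) (pairs : ∀ j → j ∉ bad → Σ (Pairs m) λ P → length P ≤ q) where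
    open DecMembership (_≟_ {ℓ}) using (_∈?_)

    newly-bad : Fin ℓ → List (Fin (L * ℓ))
    newly-bad j with j ∈? bad
    ... | yes _ = []
    ... | no j∉ = List.map (λ i → combine i j) (concatMap clash (proj₁ (pairs j j∉)))

    length-newly-bad : ∀ j → length (newly-bad j) ≤ q * κ
    length-newly-bad j with j ∈? bad
    ... | yes _ = z≤n
    ... | no j∉ = ≤-trans (≤-reflexive (length-map (λ i → combine i j) (concatMap clash (proj₁ (pairs j j∉)))))
      (≤-trans (length-concatMap≤ clash length-clash (proj₁ (pairs j j∉))) (*-monoˡ-≤ κ (proj₂ (pairs j j∉))))

    -- A union bound: every extension of a bad seed, and for each good seed the hashes that confuse
    -- one of the pairs belonging to that seed.
    all-bad : List (Fin (L * ℓ))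
    all-bad = cartesianProductWith combine (List.allFin L) bad ++ concatMap newly-bad (List.allFin ℓ)

    length-allFin : ∀ k → length (List.allFin k) ≡ k
    length-allFin k = length-tabulate {n = k} id

    length-all-bad : length all-bad ≤ L * length bad + ℓ * (q * κ)
    length-all-bad = ≤-trans (≤-reflexive (length-++ (cartesianProductWith combine (List.allFin L) bad)))
      (+-mono-≤ (≤-reflexive (trans (length-cartesianProductWith combine (List.allFin L) bad) (cong (_* length bad) (length-allFin L))))
                (≤-trans (length-concatMap≤ newly-bad length-newly-bad (List.allFin ℓ)) (≤-reflexive (cong (_* (q * κ)) (length-allFin ℓ)))))

    avoids : ∀ i j → combine i j ∉ all-bad → Σ (j ∉ bad) λ j∉ → Distinguishes (H i) (proj₁ (pairs j j∉))
    avoids i j ∉all with j ∈? bad in eq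
    ... | yes j∈ = contradiction (∈-++⁺ˡ (∈-cartesianProductWith⁺ combine (∈-allFin i) j∈)) ∉all
    ... | no j∉ = j∉ , distinguishes λ i∈ → ∉all (∈-++⁺ʳ (cartesianProductWith combine (List.allFin L) bad)
      (∈-concatMap⁺ newly-bad {xs = List.allFin ℓ} (lose (∈-allFin j) (member i∈))))
      where
      member : i ∈ concatMap clash (proj₁ (pairs j j∉)) → combine i j ∈ newly-bad j
      member i∈ rewrite eq = ∈-map⁺ (λ i → combine i j) i∈

-- The seed is read in base `L`, one digit per hash function, and the weight is written in base `b`
-- with the latest hash as its last digit.
layered : ∀ {m L} → ℕ → (Fin L → Fin m → ℕ) → ∀ d → Fin (L ^ d) → Fin m → ℕ
layered b H zero _ _ = 0
layered {L = L} b H (suc d) j e = b * layered b H d (proj₂ (remQuot {L} (L ^ d) j)) e + H (proj₁ (remQuot {L} (L ^ d) j)) e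

layered< : ∀ {m L} b (H : Fin L → Fin m → ℕ) → (∀ i e → H i e < b) → ∀ d j e → layered b H d j e < b ^ d
layered< b H H< zero j e = s≤s z≤n
layered< {L = L} b H H< (suc d) j e = begin-strict
  b * w + H i e <⟨ +-monoʳ-< (b * w) (H< i e) ⟩
  b * w + b ≡⟨ trans (+-comm (b * w) b) (sym (*-suc b w)) ⟩
  b * suc w ≤⟨ *-monoʳ-≤ b (layered< b H H< d (proj₂ (remQuot {L} (L ^ d) j)) e) ⟩
  b * b ^ d ∎
  where
  open ≤-Reasoning
  i = proj₁ (remQuot {L} (L ^ d) j)
  w = layered b H d (proj₂ (remQuot {L} (L ^ d) j)) e

pairBound : ℕ → ℕ → ℕ
pairBound N s = N * K⁶ s

-- A good seed has at most `pairBound N s` pairs with at most `κ` collisions each; `2 * D` times as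
-- many hashes make these a `1 / (2 * D)` fraction.
familySize : ℕ → ℕ → ℕ → ℕ → ℕ
familySize N s D κ = 2 * D * (pairBound N s * κ)

module Isolation {n m : ℕ} (G : Graph (suc n) m) (s : ℕ) (1≤s : 1 ≤ s)
  (N D κ b : ℕ) (1≤N : 1 ≤ N)
  (H : Fin (familySize N s D κ) → Fin m → ℕ) (H< : ∀ i X → weight (H i) X < b)
  (few : ∀ X Y → ¬ X ≡ Y → collisions H X Y ≤ κ) where

  q L : ℕ
  q = pairBound N s
  L = familySize N s D κ

  ω : ∀ d → Fin (L ^ d) → Fin m → ℕ
  ω = layered b H

  -- The bad fraction is at most `d / (2 * D)`, which reaches one half at `d = D`.
  MostlyGood : ∀ d → (Fin (L ^ d) → Set) → Set
  MostlyGood d Good = Σ (List (Fin (L ^ d))) λ bad → length bad * (2 * D) ≤ d * L ^ d × (∀ j → j ∉ bad → Good j)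

  -- One more hash spoils at most a 1/(2D) fraction of the indices.
  mostlyGood-suc : ∀ {d} {Good : Fin (L ^ d) → Set} {Good′ : Fin (L ^ suc d) → Set} → MostlyGood d Good →
    (∀ j → Good j → Σ (Pairs m) λ P → length P ≤ q ×
      (∀ j′ → Refines G (ω (suc d) j′) (ω d j) → Distinguishes (ω (suc d) j′) P → Good′ j′)) →
    MostlyGood (suc d) Good′
  mostlyGood-suc {d} {Good} {Good′} (bad , bad≤ , good) improve = all-bad H few bad pairs , bad≤′ , good′
    where
    pairs : ∀ j → j ∉ bad → Σ (Pairs m) λ P → length P ≤ q
    pairs j j∉ = proj₁ (improve j (good j j∉)) , proj₁ (proj₂ (improve j (good j j∉)))
    bad≤′ : length (all-bad H few bad pairs) * (2 * D) ≤ suc d * L ^ suc d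
    bad≤′ = begin
      length (all-bad H few bad pairs) * (2 * D) ≤⟨ *-monoˡ-≤ (2 * D) (length-all-bad H few bad pairs) ⟩
      -- The product `2 * D * (q * κ)` that appears is `L` by definition.
      (L * length bad + L ^ d * (q * κ)) * (2 * D) ≡⟨ regroup L (length bad) (L ^ d) (q * κ) (2 * D) ⟩
      L ^ d * L + L * (length bad * (2 * D)) ≤⟨ +-monoʳ-≤ (L ^ d * L) (*-monoʳ-≤ L bad≤) ⟩
      L ^ d * L + L * (d * L ^ d) ≡⟨ collect L (L ^ d) d ⟩
      suc d * L ^ suc d ∎
      where
      open ≤-Reasoning
      regroup : ∀ L b ℓ x D → (L * b + ℓ * x) * D ≡ ℓ * (D * x) + L * (b * D)
      regroup = solve-∀
      collect : ∀ L ℓ d → ℓ * L + L * (d * ℓ) ≡ suc d * (L * ℓ)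
      collect = solve-∀
    good′ : ∀ j′ → j′ ∉ all-bad H few bad pairs → Good′ j′
    good′ j′ ∉bad = finish (avoids H few bad pairs i j (subst (_∉ all-bad H few bad pairs) (sym (combine-remQuot {L} (L ^ d) j′)) ∉bad))
      where
      i = proj₁ (remQuot {L} (L ^ d) j′)
      j = proj₂ (remQuot {L} (L ^ d) j′)
      finish : (Σ (j ∉ bad) λ j∉ → Distinguishes (H i) (proj₁ (pairs j j∉))) → Good′ j′
      finish (j∉ , dist) = proj₂ (proj₂ (improve j (good j j∉))) j′
        (scaled-refines G {ω d j} (H< i)) (scaled-distinguishes G {ω d j} (H< i) dist)

  -- Children at most triple the number of pieces, so the factor `3 ^ d` makes the hypothesis
  -- hereditary and every level has at most `N` pieces.
  mostlySolved : ∀ d (F : List (Piece G s 1≤s d)) → length F * 3 ^ d ≤ N → MostlyGood d (λ j → SolvedAll G s 1≤s (ω d j) F)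
  mostlySolved zero F _ = [] , z≤n , λ _ _ → solved-leaves G s 1≤s F
  mostlySolved (suc d) F F≤ = mostlyGood-suc {d} (mostlySolved d (children G s 1≤s F) children≤) improve
    where
    children≤ : length (children G s 1≤s F) * 3 ^ d ≤ N
    children≤ = ≤-trans (*-monoˡ-≤ (3 ^ d) (length-children G s 1≤s F))
      (≤-trans (≤-reflexive (regroup (length F) (3 ^ d))) F≤)
      where
      regroup : ∀ f t → 3 * f * t ≡ f * (3 * t)
      regroup = solve-∀
    F≤N : length F ≤ N
    F≤N = ≤-trans (m≤m*n (length F) (3 ^ suc d) {{m^n≢0 3 (suc d)}}) F≤
    improve : ∀ j → SolvedAll G s 1≤s (ω d j) (children G s 1≤s F) → Σ (Pairs m) λ P → length P ≤ q ×
      (∀ j′ → Refines G (ω (suc d) j′) (ω d j) → Distinguishes (ω (suc d) j′) P → SolvedAll G s 1≤s (ω (suc d) j′) F)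
    improve j solved = let P , P≤ , solve = solved-forest G s 1≤s F solved in
      P , ≤-trans P≤ (*-monoˡ-≤ (K⁶ s) F≤N) , λ j′ → solve (ω (suc d) j′)

  minimal-exists : ∀ ω Z → hamiltonian G Z ≡ true → ∃[ X ] Minimal G ω X
  minimal-exists ω Z ham = descend Z ham (<-wellFounded (weight ω Z))
    where
    descend : ∀ Z → hamiltonian G Z ≡ true → Acc _<_ (weight ω Z) → ∃[ X ] Minimal G ω X
    descend Z ham (acc rec) with anySubset? (λ Y → (hamiltonian G Y ≟ᵇ true) ×-dec (weight ω Y <? weight ω Z))
    ... | yes (Y , hamY , lt) = descend Y hamY (rec lt)
    ... | no least = Z , ham , λ Y hamY → ≮⇒≥ λ lt → least (Y , hamY , lt)

  isolates : ∀ {ω} (C : List (Subset m)) → (∀ Z → Minimal G ω Z → Z ∈ C) → Distinguishes ω (cartesianProduct C C) →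
    (∃[ Z ] HC G Z) → Isolates ω (HC G)
  isolates {ω} C listed dist (Z , hc) = let X , ham , min = minimal-exists ω Z (HC⇒hamiltonian G Z hc) in
    X , hamiltonian⇒HC G X ham , (λ Y hcY → min Y (HC⇒hamiltonian G Y hcY)) , unique X ham min
    where
    unique : ∀ X → hamiltonian G X ≡ true → (∀ Y → hamiltonian G Y ≡ true → weight ω X ≤ weight ω Y) →
      ∀ Y → HC G Y → weight ω Y ≡ weight ω X → Y ≡ X
    unique X ham min Y hcY eq with Y ≟ˢ X
    ... | yes p = p
    ... | no ne = contradiction eq (dist Y X (∈-cartesianProduct⁺ (listed Y minY) (listed X (ham , min))) ne)
      where
      minY : Minimal G ω Y
      minY = HC⇒hamiltonian G Y hcY , λ W hamW → ≤-trans (≤-reflexive eq) (min W hamW)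

  -- At the root at most `K s` candidates contain all minimisers. One last hash gives them distinct
  -- weights, so the minimum is unique. They form fewer pairs than a level may have, so the same
  -- family suffices.
  mostlyIsolating : ∀ {d} → Balanced G s d (λ _ → true) → 3 ^ d ≤ N → (∃[ Z ] HC G Z) →
    MostlyGood (suc d) (λ j → Isolates (ω (suc d) j) (HC G))
  mostlyIsolating {d} T 3^d≤N hc = mostlyGood-suc {d}
    (mostlySolved d ((_ , T) ∷ []) (≤-trans (≤-reflexive (+-identityʳ (3 ^ d))) 3^d≤N)) improve
    where
    k = K s
    1≤k : 1 ≤ k
    1≤k = m^n>0 6 s
    k²≤q : k * k ≤ q
    k²≤q = begin
      k * k ≤⟨ m≤n*m (k * k) k {{>-nonZero 1≤k}} ⟩
      k * (k * k) ≤⟨ m≤n*m (k * (k * k)) (k * (k * k)) {{>-nonZero (*-mono-≤ 1≤k (*-mono-≤ 1≤k 1≤k))}} ⟩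
      K⁶ s ≤⟨ m≤n*m (K⁶ s) N {{>-nonZero 1≤N}} ⟩
      q ∎
      where open ≤-Reasoning
    restrict-all : ∀ Z → restrict (λ _ → true) Z ≡ Z
    restrict-all Z = subset-ext λ e → lookup-restrict (λ _ → true) Z e
    improve : ∀ j → SolvedAll G s 1≤s (ω d j) ((_ , T) ∷ []) → Σ (Pairs m) λ P → length P ≤ q ×
      (∀ j′ → Refines G (ω (suc d) j′) (ω d j) → Distinguishes (ω (suc d) j′) P → Isolates (ω (suc d) j′) (HC G))
    improve j ((C , C≤ , listed) ∷ []) = cartesianProduct C C ,
      ≤-trans (≤-reflexive (length-cartesianProductWith _,_ C C)) (≤-trans (*-mono-≤ C≤ C≤) k²≤q) ,
      λ j′ refines dist → isolates {ω (suc d) j′} C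
        (λ Z min → subst (_∈ C) (restrict-all Z) (listed Z (refines Z min))) dist hc

-- Good seeds, choice of parameters and the final bounds

unlisted : ∀ {k} → List (Fin k) → Subset k
unlisted {k} bad = Vec.tabulate (λ i → not (does (i ∈? bad)))
  where open DecMembership (_≟_ {k}) using (_∈?_)

∈-unlisted : ∀ {k} (bad : List (Fin k)) i → lookup (unlisted bad) i ≡ true → i ∉ bad
∈-unlisted {k} bad i p i∈ = contradiction (trans (sym p) (trans (lookup∘tabulate _ i) (cong not (dec-true (i ∈? bad) i∈)))) λ ()
  where open DecMembership (_≟_ {k}) using (_∈?_)

∣tabulate∣ : ∀ {k} (f : Fin k → Bool) → ∣ Vec.tabulate f ∣ ≡ count f
∣tabulate∣ {zero} f = refl
∣tabulate∣ {suc k} f with f zero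
... | true = cong suc (∣tabulate∣ (f ∘ suc))
... | false = ∣tabulate∣ (f ∘ suc)

count-member≤ : ∀ {k} (bad : List (Fin k)) → (let open DecMembership (_≟_ {k})) → count (λ i → does (i ∈? bad)) ≤ length bad
count-member≤ {k} [] = ≤-reflexive (trans (sumF-const k 0) (*-zeroʳ k))
count-member≤ {k} (b ∷ bad) = begin
  count (λ i → does (i ∈? (b ∷ bad))) ≤⟨ sumF-mono pointwise ⟩
  sumF (λ i → ind (does (toℕ i ≟ℕ toℕ b)) + ind (does (i ∈? bad))) ≡⟨ sumF-+ {k} (λ i → ind (does (toℕ i ≟ℕ toℕ b))) (λ i → ind (does (i ∈? bad))) ⟩
  sumF {k} (λ i → ind (does (toℕ i ≟ℕ toℕ b))) + count (λ i → does (i ∈? bad)) ≤⟨ +-mono-≤ (sumF-ind-≡ k (toℕ b)) (count-member≤ bad) ⟩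
  suc (length bad) ∎
  where
  open ≤-Reasoning
  open DecMembership (_≟_ {k}) using (_∈?_)
  pointwise : ∀ i → ind (does (i ∈? (b ∷ bad))) ≤ ind (does (toℕ i ≟ℕ toℕ b)) + ind (does (i ∈? bad))
  pointwise i with i ≟ b
  ... | yes refl rewrite dec-true (toℕ i ≟ℕ toℕ i) refl = s≤s z≤n
  ... | no _ = m≤n+m _ (ind (does (toℕ i ≟ℕ toℕ b)))

∣unlisted∣ : ∀ {k} (bad : List (Fin k)) → k ≤ ∣ unlisted bad ∣ + length bad
∣unlisted∣ {k} bad = begin
  k ≡⟨ sym (trans (sumF-const k 1) (*-identityʳ k)) ⟩
  sumF {k} (λ _ → 1) ≡⟨ sumF-cong (λ i → sym (either (does (i ∈? bad)))) ⟩
  sumF {k} (λ i → ind (not (does (i ∈? bad))) + ind (does (i ∈? bad))) ≡⟨ sumF-+ {k} (λ i → ind (not (does (i ∈? bad)))) (λ i → ind (does (i ∈? bad))) ⟩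
  count (λ i → not (does (i ∈? bad))) + count (λ i → does (i ∈? bad))
    ≤⟨ +-mono-≤ (≤-reflexive (sym (∣tabulate∣ (λ i → not (does (i ∈? bad)))))) (count-member≤ bad) ⟩
  ∣ unlisted bad ∣ + length bad ∎
  where
  open ≤-Reasoning
  open DecMembership (_≟_ {k}) using (_∈?_)
  either : ∀ b → ind (not b) + ind b ≡ 1
  either true = refl
  either false = refl

n≤2^⌈log₂n⌉ : ∀ n → n ≤ 2 ^ ⌈log₂ n ⌉
n≤2^⌈log₂n⌉ n = go ⌈log₂ n ⌉ n refl
  where
  go : ∀ k n → ⌈log₂ n ⌉ ≡ k → n ≤ 2 ^ k
  go k 0 eq = z≤n
  go k 1 eq = m^n>0 2 k
  go zero (suc (suc n)) eq = contradiction (≤-trans (⌈log₂⌉-mono-≤ {2} {2 + n} (s≤s (s≤s z≤n))) (≤-reflexive eq)) λ ()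
  go (suc k) (suc (suc n)) eq = begin
    2 + n ≡⟨ sym (⌊n/2⌋+⌈n/2⌉≡n (2 + n)) ⟩
    ⌊ 2 + n /2⌋ + ⌈ 2 + n /2⌉ ≤⟨ +-mono-≤ (≤-trans (⌊n/2⌋≤⌈n/2⌉ (2 + n)) half) half ⟩
    2 ^ k + 2 ^ k ≡⟨ sym (2^suc k) ⟩
    2 ^ suc k ∎
    where
    open ≤-Reasoning
    half : ⌈ 2 + n /2⌉ ≤ 2 ^ k
    half = go k ⌈ 2 + n /2⌉ (trans (⌈log₂⌈n/2⌉⌉≡⌈log₂n⌉∸1 (2 + n)) (cong (_∸ 1) eq))

edges≤ : ∀ {n m} → Graph n m → m ≤ n * n
edges≤ G = injective⇒≤ {f = λ e → combine (proj₁ (ends G e)) (proj₂ (ends G e))} λ {e} {f} eq →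
  let p , q = combine-injective (proj₁ (ends G e)) (proj₂ (ends G e)) (proj₁ (ends G f)) (proj₂ (ends G f)) eq
  in simple G e f (cong₂ _,_ p q)

Scheme : ℕ → ℕ → ℕ → ℕ → Set
Scheme c t n m =
    Σ ℕ λ ℓ → Σ (Fin ℓ → Fin m → ℕ) λ ω →
    (1 ≤ ℓ) × (ℓ ≤ 2 ^ bound c t n) ×
    (∀ i e → ω i e ≤ 2 ^ bound c t n) ×
    (∀ (G : Graph n m) → TreewidthAtMost G t → (∃[ X ] HC G X) → IsolatesHalf G ω)

vacuous : ∀ c t n m → ((G : Graph n m) → ¬ (∃[ X ] HC G X)) → Scheme c t n m
vacuous c t n m none = 1 , (λ _ _ → 0) , s≤s z≤n , m^n>0 2 (bound c t n) , (λ _ _ → z≤n) ,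
  λ G _ hc → contradiction hc (none G)

double≡ : ∀ d → double d ≡ d + d
double≡ zero = refl
double≡ (suc d) = cong suc (trans (cong suc (double≡ d)) (sym (+-suc d d)))

-- A record, so that Agda can infer the exponent a.
record _≤2^_ (x a : ℕ) : Set where
  constructor bits
  field
    unbits : x ≤ 2 ^ a

open _≤2^_

_*ᵇ_ : ∀ {x y a b} → x ≤2^ a → y ≤2^ b → (x * y) ≤2^ (a + b)
_*ᵇ_ {a = a} {b} (bits p) (bits q) = bits (≤-trans (*-mono-≤ p q) (≤-reflexive (sym (^-distribˡ-+-* 2 a b))))

sucᵇ : ∀ {x a} → x ≤2^ a → suc x ≤2^ suc a
sucᵇ {x} {a} (bits p) = bits (≤-trans (+-mono-≤ (m^n>0 2 a) p) (≤-reflexive (sym (2^suc a))))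

doubleᵇ : ∀ {x a} → x ≤2^ a → (2 * x) ≤2^ suc a
doubleᵇ (bits p) = bits (*-monoʳ-≤ 2 p)

weakenᵇ : ∀ {x a b} → a ≤ b → x ≤2^ a → x ≤2^ b
weakenᵇ le (bits p) = bits (≤-trans p (^-monoʳ-≤ 2 le))

powerᵇ : ∀ {x a} → x ≤2^ a → ∀ d → (x ^ d) ≤2^ (a * d)
powerᵇ {x} {a} (bits p) d = bits (≤-trans (^-monoˡ-≤ d p) (≤-reflexive (^-*-assoc 2 a d)))

1+n≤2^n : ∀ n → suc n ≤2^ n
1+n≤2^n zero = bits (s≤s z≤n)
1+n≤2^n (suc n) = sucᵇ (1+n≤2^n n)

-- Here l bounds log₂ of the number of vertices.
module Parameters (t l m : ℕ) (1≤l : 1 ≤ l) (m≤ : m ≤2^ (l + l)) where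

  depth s D κ N L r b : ℕ
  -- At most `2 ^ (l + l)` edges are balanced into depth `double (l + l)`. Below, `s` counts two
  -- bags of `suc t` vertices, and `D` has one extra round for the root.
  depth = double (l + l)
  s = suc t + suc t
  D = suc depth
  κ = 1 + 2 * m
  N = 3 ^ depth
  L = familySize N s D κ
  -- This range meets the condition of `hash-family`. The base `b` exceeds both a single value `r`
  -- and the weight `m * r` of any set.
  r = 2 * L
  b = suc (suc m * r)

  depth≡ : depth ≡ 4 * l
  depth≡ = trans (double≡ (l + l)) (four l)
    where
    four : ∀ l → l + l + (l + l) ≡ 4 * l
    four = solve-∀

  1≤K⁶ : 1 ≤ K⁶ s
  1≤K⁶ = *-mono-≤ 1≤K³ 1≤K³
    where
    1≤K = m^n>0 6 s
    1≤K³ : 1 ≤ K s * (K s * K s)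
    1≤K³ = *-mono-≤ 1≤K (*-mono-≤ 1≤K 1≤K)

  1≤L : 1 ≤ L
  1≤L = *-mono-≤ {1} {2 * D} (s≤s z≤n) (*-mono-≤ (*-mono-≤ (m^n>0 3 depth) 1≤K⁶) (s≤s {0} {2 * m} z≤n))

  D≤5l : D ≤ 5 * l
  D≤5l = ≤-trans (≤-reflexive (cong suc depth≡)) (+-monoˡ-≤ (4 * l) 1≤l)

  K≤ : K s ≤2^ (3 * s)
  K≤ = bits (≤-trans (^-monoˡ-≤ s {6} {8} (m≤m+n 6 2)) (≤-reflexive (^-*-assoc 2 3 s)))

  K⁶≤ : K⁶ s ≤2^ ((3 * s + (3 * s + 3 * s)) + (3 * s + (3 * s + 3 * s)))
  K⁶≤ = K³≤ *ᵇ K³≤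
    where
    K³≤ = K≤ *ᵇ (K≤ *ᵇ K≤)

  N≤ : N ≤2^ (2 * (4 * l))
  N≤ = bits (≤-trans (^-monoˡ-≤ depth {3} {4} (m≤m+n 3 1)) (≤-reflexive (trans (^-*-assoc 2 2 depth) (cong (λ d → 2 ^ (2 * d)) depth≡))))

  κ≤ : κ ≤2^ suc (suc (l + l))
  κ≤ = sucᵇ (doubleᵇ m≤)

  2D≤ : (2 * D) ≤2^ suc (2 + l)
  2D≤ = doubleᵇ (bits (begin
    D ≡⟨ cong suc depth≡ ⟩
    suc (4 * l) ≤⟨ m≤n+m _ 3 ⟩
    4 + 4 * l ≡⟨ sym (*-suc 4 l) ⟩
    4 * suc l ≤⟨ *-monoʳ-≤ 4 (unbits (1+n≤2^n l)) ⟩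
    4 * 2 ^ l ≡⟨ sym (^-distribˡ-+-* 2 2 l) ⟩
    2 ^ (2 + l) ∎))
    where open ≤-Reasoning

  -- The factor `K⁶` contributes 18 s = 36 t + 36 to the exponent and the other factors 11 l + 5.
  -- The constant 41 is absorbed into 41 l, as `1 ≤ l`.
  a : ℕ
  a = 36 * t + 52 * l

  L≤ : L ≤2^ a
  L≤ = weakenᵇ exponent (2D≤ *ᵇ ((N≤ *ᵇ K⁶≤) *ᵇ κ≤))
    where
    simplify : ∀ t l → let s = suc t + suc t in
      suc (2 + l) + ((2 * (4 * l) + ((3 * s + (3 * s + 3 * s)) + (3 * s + (3 * s + 3 * s)))) + suc (suc (l + l)))
        ≡ 36 * t + 11 * l + 41 * 1
    simplify = solve-∀
    regroup : ∀ t l → 36 * t + 11 * l + 41 * l ≡ 36 * t + 52 * l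
    regroup = solve-∀
    exponent : suc (2 + l) + ((2 * (4 * l) + ((3 * s + (3 * s + 3 * s)) + (3 * s + (3 * s + 3 * s)))) + suc (suc (l + l))) ≤ a
    exponent = ≤-trans (≤-reflexive (simplify t l))
      (≤-trans (+-monoʳ-≤ (36 * t + 11 * l) (*-monoʳ-≤ 41 1≤l)) (≤-reflexive (regroup t l)))

  b≤ : b ≤2^ (36 * t + 57 * l)
  b≤ = weakenᵇ exponent (sucᵇ (sucᵇ m≤ *ᵇ doubleᵇ {L} L≤))
    where
    simplify : ∀ t l → suc (suc (l + l) + suc (36 * t + 52 * l)) ≡ 36 * t + 54 * l + 3 * 1
    simplify = solve-∀
    regroup : ∀ t l → 36 * t + 54 * l + 3 * l ≡ 36 * t + 57 * l
    regroup = solve-∀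
    exponent : suc (suc (l + l) + suc a) ≤ 36 * t + 57 * l
    exponent = ≤-trans (≤-reflexive (simplify t l))
      (≤-trans (+-monoʳ-≤ (36 * t + 54 * l) (*-monoʳ-≤ 3 1≤l)) (≤-reflexive (regroup t l)))

  power-D≤ : ∀ {x k} → k ≤ 57 → x ≤2^ (36 * t + k * l) → x ^ D ≤ 2 ^ (300 * (t * l + l * l))
  power-D≤ {x} {k} k≤ x≤ = unbits (weakenᵇ exponent (powerᵇ x≤ D))
    where
    -- The product is 180 t l + 285 l², and 300 is 285 rounded up.
    expand : ∀ t l → (36 * t + 57 * l) * (5 * l) + (120 * (t * l) + 15 * (l * l)) ≡ 300 * (t * l + l * l)
    expand = solve-∀
    exponent : (36 * t + k * l) * D ≤ 300 * (t * l + l * l)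
    exponent = begin
      (36 * t + k * l) * D ≤⟨ *-mono-≤ (+-monoʳ-≤ (36 * t) (*-monoˡ-≤ l k≤)) D≤5l ⟩
      (36 * t + 57 * l) * (5 * l) ≤⟨ m≤m+n _ _ ⟩
      (36 * t + 57 * l) * (5 * l) + (120 * (t * l) + 15 * (l * l)) ≡⟨ expand t l ⟩
      300 * (t * l + l * l) ∎
      where open ≤-Reasoning

  hashes : Σ (Fin L → Fin m → ℕ) λ H → (∀ i e → H i e ≤ r) × (∀ X Y → ¬ X ≡ Y → collisions H X Y ≤ κ)
  hashes = hash-family m L r (n≤1+n r)

  H : Fin L → Fin m → ℕ
  H = proj₁ hashes

  H< : ∀ i e → H i e < b
  H< i e = s≤s (≤-trans (proj₁ (proj₂ hashes) i e) (m≤m+n r (m * r)))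

  weight-H< : ∀ i X → weight (H i) X < b
  weight-H< i X = s≤s (≤-trans (weight≤ (H i) (proj₁ (proj₂ hashes) i) X) (m≤n+m (m * r) r))

  isolatesHalf : ∀ {n} (G : Graph (suc n) m) → TreewidthAtMost G t → (∃[ X ] HC G X) → IsolatesHalf G (layered b H D)
  isolatesHalf G tw hc = unlisted bad , half , λ j j∈ → good j (∈-unlisted bad j ([]=⇒lookup j∈))
    where
    open Isolation G s (s≤s z≤n) N D κ b (m^n>0 3 depth) H weight-H< (proj₂ (proj₂ hashes)) using (mostlyIsolating)
    tree = Contract.edge-tree G tw
    mostly = mostlyIsolating {depth}
      (proj₁ (balance G (suc t) (l + l)) (proj₁ tree) (≤-trans (proj₂ tree) (unbits m≤))) ≤-refl hc
    bad = proj₁ mostly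
    good = proj₂ (proj₂ mostly)
    -- After all `D` rounds the bad fraction is D / (2D); cancelling `D` gives one half.
    2bad≤ : 2 * length bad ≤ L ^ D
    2bad≤ = *-cancelʳ-≤ _ _ D (≤-trans (≤-reflexive (regroup (length bad) D)) (≤-trans (proj₁ (proj₂ mostly)) (≤-reflexive (*-comm D (L ^ D)))))
      where
      regroup : ∀ x D → 2 * x * D ≡ x * (2 * D)
      regroup = solve-∀
    half : L ^ D ≤ 2 * ∣ unlisted bad ∣
    half = +-cancelʳ-≤ (L ^ D) _ _ (begin
      L ^ D + L ^ D ≤⟨ +-mono-≤ (∣unlisted∣ bad) (∣unlisted∣ bad) ⟩
      (∣ unlisted bad ∣ + length bad) + (∣ unlisted bad ∣ + length bad) ≡⟨ regroup ∣ unlisted bad ∣ (length bad) ⟩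
      2 * ∣ unlisted bad ∣ + 2 * length bad ≤⟨ +-monoʳ-≤ (2 * ∣ unlisted bad ∣) 2bad≤ ⟩
      2 * ∣ unlisted bad ∣ + L ^ D ∎)
      where
      open ≤-Reasoning
      regroup : ∀ x y → (x + y) + (x + y) ≡ 2 * x + 2 * y
      regroup = solve-∀

scheme : ∀ t n m → Scheme 300 t n m
scheme t n m with 3 ≤? n | m ≤? n * n
-- With fewer than three vertices there is no Hamiltonian cycle, and with more than n² edges no
-- graph. In the remaining case `1 ≤ l` holds, which absorbs the additive constants.
... | no n<3 | _ = vacuous 300 t n m λ { G (_ , 3≤n , _) → n<3 3≤n }
... | yes _ | no m> = vacuous 300 t n m λ G _ → m> (edges≤ G)
scheme t (suc n) m | yes 3≤n | yes m≤n² = L ^ D , layered b H D , m^n>0 L {{>-nonZero 1≤L}} D ,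
    power-D≤ (m≤m+n 52 5) L≤ ,
    (λ j e → ≤-trans (<⇒≤ (layered< b H H< D j e)) (power-D≤ ≤-refl b≤)) ,
    λ G → isolatesHalf G
  where
  l : ℕ
  l = ⌈log₂ suc n ⌉
  1≤l : 1 ≤ l
  1≤l = ⌈log₂⌉-mono-≤ {2} {suc n} (≤-trans (n≤1+n 2) 3≤n)
  n≤ : suc n ≤2^ l
  n≤ = bits (n≤2^⌈log₂n⌉ (suc n))
  m≤ : m ≤2^ (l + l)
  m≤ = bits (≤-trans m≤n² (unbits (n≤ *ᵇ n≤)))
  open Parameters t l m 1≤l m≤

theorem1p2 : ∃[ c ] ∀ (t : ℕ) → ∀ (n m : ℕ) →
    Σ ℕ λ ℓ → Σ (Fin ℓ → Fin m → ℕ) λ ω →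
    (1 ≤ ℓ) × (ℓ ≤ 2 ^ bound c t n) ×
    (∀ i e → ω i e ≤ 2 ^ bound c t n) ×
    (∀ (G : Graph n m) → TreewidthAtMost G t → (∃[ X ] HC G X) → IsolatesHalf G ω)
theorem1p2 = 300 , scheme
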